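{- Let $\Phi=(D,\varphi)$ be a $\mathbb{T}$-gain digraph on $n$ vertices with gain adjacency matrix $A(\Phi)$. Let $\mathcal{E}_n(D)$ denote the set of all spanning elementary subdigraphs of $D$, and for $\mathsf{E}\in\mathcal{E}_n(D)$ let $\varphi(\mathsf{E})=\prod_{C\in\mathsf{E}}\varphi(C)$ denote its gain (product over the directed cycles $C$ composing $\mathsf{E}$). Then $$\det(A(\Phi))=\sum_{\mathsf{E}\in\mathcal{E}_n(D)}(-1)^{n-c(\mathsf{E})}\varphi(\mathsf{E}).$$
   Context: A digraph $D=(V,\mathcal{A})$ has a finite vertex set $V=\{v_1,\dots,v_n\}$ and a set $\mathcal{A}$ of ordered pairs of distinct vertices, called arcs (no loops; at most one arc from $v_i$ to $v_j$ for each ordered pair; opposite arcs may both be present). A directed cycle is a closed directed walk whose vertices are distinct except that the first and last coincide (so its length is at least $2$; length $2$ is allowed). Let $\mathbb{T}=\{z\in\mathbb{C}:|z|=1\}$. A $\mathbb{T}$-gain digraph is a pair $\Phi=(D,\varphi)$ with $\varphi:\mathcal{A}\to\mathbb{T}$ an arbitrary function. Its gain adjacency matrix $A(\Phi)$ has entries $A(\Phi)_{ij}=\varphi(v_i,v_j)$ if $(v_i,v_j)\in\mathcal{A}$ and $0$ otherwise. An elementary subdigraph of $D$ is a subdigraph in which every vertex has in-degree and out-degree exactly $1$, equivalently a vertex-disjoint union of directed cycles of $D$; it is spanning if it covers all $n$ vertices. $c(\mathsf{E})$ is the number of directed cycles composing $\mathsf{E}$. The gain $\varphi(C)$ of a directed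 cycle is the product of the gains of its arcs. -}

module Defs where

open import Algebra.Bundles using (CommutativeRing)
open import Algebra.Structures using (IsCommutativeRing)
import Algebra.Properties.CommutativeSemigroup as CommutativeSemigroupProperties
import Algebra.Properties.Ring as RingProperties
import Algebra.Properties.Group as GroupProperties
import Algebra.Properties.Semiring.Exp as SemiringExp
open import Data.Fin.Base as Fin using (Fin)
import Data.Fin.Properties as Fin
open import Data.Fin.Subset using (Subset; inside; outside; _∈_; _∉_; _⊆_; ∣_∣)
open import Data.Fin.Subset.Properties using (_∈?_; _⊆?_)
open import Data.List.Base as List
  using (List; []; _∷_; [_]; allFin; upTo; concatMap; cartesianProduct; cartesianProductWith; filter; length; map; foldr)
open import Data.List.Relation.Unary.All using (All; all?)
open import Data.List.Relation.Unary.Unique.Propositional using (Unique)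
import Data.List.Relation.Unary.Unique.DecPropositional as DecUnique
open import Data.Nat.Base as ℕ using (ℕ; zero; suc; _∸_)
import Data.Nat.Properties as ℕ
open import Data.Product.Base using (Σ; ∃; _×_; _,_; proj₁; proj₂)
open import Data.Rational.Base as ℚ using (ℚ; 0ℚ; 1ℚ; ½)
import Data.Rational.Properties as ℚ
open import Data.Vec.Base as Vec using (Vec; []; _∷_; lookup; toList)
open import Function.Base using (_∘_)
open import Level using (Level; 0ℓ)
open import Relation.Binary.Structures using (IsEquivalence)
open import Relation.Binary.PropositionalEquality.Core using (_≡_; refl; sym; trans; cong; cong₂; subst)
open import Relation.Nullary.Decidable.Core using (Dec; yes; no; _×-dec_)
open import Relation.Unary using (Pred; Decidable)

private
  variable
    a p : Level
    A : Set a
    n : ℕ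

------------------------------------------------------------------------
-- Real numbers: Cauchy sequences of rationals

-- x ∼ x says that x is a Cauchy sequence; between Cauchy sequences, x ∼ y
-- says that x and y have the same limit.
infix 4 _∼_
record _∼_ (x y : ℕ → ℚ) : Set where
  constructor mk∼
  field
    close : ∀ ε → 0ℚ ℚ.< ε →
            ∃ λ N → ∀ m n → N ℕ.≤ m → N ℕ.≤ n → ℚ.∣ x m ℚ.- y n ∣ ℚ.< ε

open _∼_ public

record ℝ : Set where
  constructor mkℝ
  field
    seq    : ℕ → ℚ
    cauchy : seq ∼ seq

open ℝ public

infix 4 _≈ℝ_
record _≈ℝ_ (x y : ℝ) : Set where
  constructor mk≈ℝ
  field
    seq-∼ : seq x ∼ seq y

open _≈ℝ_ public

0≤ℝ_ : ℝ → Set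
0≤ℝ x = ∀ ε → 0ℚ ℚ.< ε → ∃ λ N → ∀ n → N ℕ.≤ n → ℚ.- ε ℚ.< seq x n

private

  Small : (ℕ → ℕ → ℚ) → Set
  Small f = ∀ ε → 0ℚ ℚ.< ε → ∃ λ N → ∀ m n → N ℕ.≤ m → N ℕ.≤ n → ℚ.∣ f m n ∣ ℚ.< ε

  Bounded : (ℕ → ℚ) → Set
  Bounded x = ∃ λ B → 0ℚ ℚ.< B × ∃ λ N → ∀ n → N ℕ.≤ n → ℚ.∣ x n ∣ ℚ.≤ B

  abstract

    diff-neg : ∀ u v → ℚ.- (u ℚ.- v) ≡ v ℚ.- u
    diff-neg = GroupProperties.⁻¹-anti-homo-// ℚ.+-0-group

    diff-cancel : ∀ u v → (u ℚ.- v) ℚ.+ v ≡ u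
    diff-cancel u v = trans (ℚ.+-assoc u (ℚ.- v) v) (trans (cong (u ℚ.+_) (ℚ.+-inverseˡ v)) (ℚ.+-identityʳ u))

    diff-trans : ∀ u v w → (u ℚ.- v) ℚ.+ (v ℚ.- w) ≡ u ℚ.- w
    diff-trans u v w = trans (sym (ℚ.+-assoc (u ℚ.- v) v (ℚ.- w))) (cong (ℚ._- w) (diff-cancel u v))

    diff-+ : ∀ u u′ v v′ → (u ℚ.- u′) ℚ.+ (v ℚ.- v′) ≡ (u ℚ.+ v) ℚ.- (u′ ℚ.+ v′)
    diff-+ u u′ v v′ = trans (CommutativeSemigroupProperties.interchange (CommutativeRing.+-commutativeSemigroup ℚ.+-*-commutativeRing) u (ℚ.- u′) v (ℚ.- v′))
      (cong (u ℚ.+ v ℚ.+_) (sym (ℚ.neg-distrib-+ u′ v′)))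

    diff-* : ∀ u u′ v v′ → u ℚ.* (v ℚ.- v′) ℚ.+ v′ ℚ.* (u ℚ.- u′) ≡ u ℚ.* v ℚ.- u′ ℚ.* v′
    diff-* u u′ v v′ = trans
      (cong₂ ℚ._+_
        (*-diff u v v′)
        (trans (*-diff v′ u u′) (cong₂ ℚ._-_ (ℚ.*-comm v′ u) (ℚ.*-comm v′ u′))))
      (diff-trans (u ℚ.* v) (u ℚ.* v′) (u′ ℚ.* v′))
      where
      *-diff : ∀ a b c → a ℚ.* (b ℚ.- c) ≡ a ℚ.* b ℚ.- a ℚ.* c
      *-diff a b c = trans (ℚ.*-distribˡ-+ a b (ℚ.- c)) (cong (a ℚ.* b ℚ.+_) (sym (ℚ.neg-distribʳ-* a c)))

    small-ext : ∀ {f g : ℕ → ℕ → ℚ} → (∀ m n → f m n ≡ g m n) → Small f → Small g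
    small-ext f≡g s ε 0<ε with s ε 0<ε
    ... | N , h = N , λ m n p q → subst (λ r → ℚ.∣ r ∣ ℚ.< ε) (f≡g m n) (h m n p q)

    small-neg : ∀ {f : ℕ → ℕ → ℚ} → Small f → Small (λ m n → ℚ.- f m n)
    small-neg {f} s ε 0<ε with s ε 0<ε
    ... | N , h = N , λ m n p q → subst (ℚ._< ε) (sym (ℚ.∣-p∣≡∣p∣ (f m n))) (h m n p q)

    half-pos : ∀ ε → 0ℚ ℚ.< ε → 0ℚ ℚ.< ½ ℚ.* ε
    half-pos ε 0<ε = subst (ℚ._< ½ ℚ.* ε) (ℚ.*-zeroʳ ½) (ℚ.*-monoʳ-<-pos ½ 0<ε)

    halves : ∀ ε → ½ ℚ.* ε ℚ.+ ½ ℚ.* ε ≡ ε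
    halves ε = trans (sym (ℚ.*-distribʳ-+ ε ½ ½)) (ℚ.*-identityˡ ε)

    small-+ : ∀ {f g : ℕ → ℕ → ℚ} → Small f → Small g → Small (λ m n → f m n ℚ.+ g m n)
    small-+ {f} {g} s t ε 0<ε with s (½ ℚ.* ε) (half-pos ε 0<ε) | t (½ ℚ.* ε) (half-pos ε 0<ε)
    ... | N , h | M , k = N ℕ.⊔ M , λ m n p q →
      ℚ.≤-<-trans (ℚ.∣p+q∣≤∣p∣+∣q∣ (f m n) (g m n))
        (subst (ℚ.∣ f m n ∣ ℚ.+ ℚ.∣ g m n ∣ ℚ.<_) (halves ε)
          (ℚ.+-mono-<
            (h m n (ℕ.≤-trans (ℕ.m≤m⊔n N M) p) (ℕ.≤-trans (ℕ.m≤m⊔n N M) q))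
            (k m n (ℕ.≤-trans (ℕ.m≤n⊔m N M) p) (ℕ.≤-trans (ℕ.m≤n⊔m N M) q))))

    small-* : ∀ (f g : ℕ → ℕ → ℚ) B N → 0ℚ ℚ.< B → (∀ m n → N ℕ.≤ m → N ℕ.≤ n → ℚ.∣ g m n ∣ ℚ.≤ B) →
              Small f → Small (λ m n → g m n ℚ.* f m n)
    small-* f g B N 0<B bound s ε 0<ε = N ℕ.⊔ M , λ m n p q →
      let
        p₁ = ℕ.≤-trans (ℕ.m≤m⊔n N M) p
        q₁ = ℕ.≤-trans (ℕ.m≤m⊔n N M) q
        p₂ = ℕ.≤-trans (ℕ.m≤n⊔m N M) p
        q₂ = ℕ.≤-trans (ℕ.m≤n⊔m N M) q
      in
      begin-strict
        ℚ.∣ g m n ℚ.* f m n ∣          ≡⟨ ℚ.∣p*q∣≡∣p∣*∣q∣ (g m n) (f m n) ⟩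
        ℚ.∣ g m n ∣ ℚ.* ℚ.∣ f m n ∣    ≤⟨ ℚ.*-monoʳ-≤-nonNeg ℚ.∣ f m n ∣ {{ℚ.nonNegative (ℚ.0≤∣p∣ (f m n))}} (bound m n p₁ q₁) ⟩
        B ℚ.* ℚ.∣ f m n ∣              <⟨ ℚ.*-monoʳ-<-pos B (M-works m n p₂ q₂) ⟩
        B ℚ.* (1/B ℚ.* ε)              ≡⟨ ℚ.*-assoc B 1/B ε ⟨
        (B ℚ.* 1/B) ℚ.* ε              ≡⟨ cong (ℚ._* ε) (ℚ.*-inverseʳ B) ⟩
        1ℚ ℚ.* ε                       ≡⟨ ℚ.*-identityˡ ε ⟩
        ε                              ∎
      where
      open ℚ.≤-Reasoning
      instance
        posB : ℚ.Positive B
        posB = ℚ.positive 0<B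
        nzB : ℚ.NonZero B
        nzB = ℚ.pos⇒nonZero B
      1/B : ℚ
      1/B = ℚ.1/ B
      0<δ : 0ℚ ℚ.< 1/B ℚ.* ε
      0<δ = subst (ℚ._< 1/B ℚ.* ε) (ℚ.*-zeroʳ 1/B) (ℚ.*-monoʳ-<-pos 1/B {{ℚ.1/pos⇒pos B}} 0<ε)
      M : ℕ
      M = proj₁ (s (1/B ℚ.* ε) 0<δ)
      M-works : ∀ m n → M ℕ.≤ m → M ℕ.≤ n → ℚ.∣ f m n ∣ ℚ.< 1/B ℚ.* ε
      M-works = proj₂ (s (1/B ℚ.* ε) 0<δ)

    ∼-sym : ∀ {x y} → x ∼ y → y ∼ x
    ∼-sym {x} {y} s .close ε 0<ε with s .close ε 0<ε
    ... | N , h = N , λ m n p q →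
      subst (ℚ._< ε) (trans (sym (ℚ.∣-p∣≡∣p∣ (x n ℚ.- y m))) (cong ℚ.∣_∣ (diff-neg (x n) (y m)))) (h n m q p)

    ∼-trans : ∀ {x y z} → x ∼ y → y ∼ z → x ∼ z
    ∼-trans {x} {y} {z} s t .close ε 0<ε with s .close (½ ℚ.* ε) (half-pos ε 0<ε) | t .close (½ ℚ.* ε) (half-pos ε 0<ε)
    ... | N , h | M , k = N ℕ.⊔ M , λ m n p q →
      let
        k₀ = N ℕ.⊔ M
      in
      subst (λ r → ℚ.∣ r ∣ ℚ.< ε) (diff-trans (x m) (y k₀) (z n))
      (ℚ.≤-<-trans (ℚ.∣p+q∣≤∣p∣+∣q∣ (x m ℚ.- y k₀) (y k₀ ℚ.- z n))
        (subst (ℚ.∣ x m ℚ.- y k₀ ∣ ℚ.+ ℚ.∣ y k₀ ℚ.- z n ∣ ℚ.<_) (halves ε)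
          (ℚ.+-mono-<
            (h m k₀ (ℕ.≤-trans (ℕ.m≤m⊔n N M) p) (ℕ.m≤m⊔n N M))
            (k k₀ n (ℕ.m≤n⊔m N M) (ℕ.≤-trans (ℕ.m≤n⊔m N M) q)))))

    bounded : ∀ {x} → x ∼ x → Bounded x
    bounded {x} s with s .close 1ℚ (ℚ.positive⁻¹ 1ℚ)
    ... | N , h = 1ℚ ℚ.+ ℚ.∣ x N ∣ , ℚ.+-mono-<-≤ (ℚ.positive⁻¹ 1ℚ) (ℚ.0≤∣p∣ (x N)) , N , λ n p →
      begin
        ℚ.∣ x n ∣                          ≡⟨ cong ℚ.∣_∣ (sym (diff-cancel (x n) (x N))) ⟩
        ℚ.∣ (x n ℚ.- x N) ℚ.+ x N ∣        ≤⟨ ℚ.∣p+q∣≤∣p∣+∣q∣ (x n ℚ.- x N) (x N) ⟩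
        ℚ.∣ x n ℚ.- x N ∣ ℚ.+ ℚ.∣ x N ∣    ≤⟨ ℚ.+-monoˡ-≤ ℚ.∣ x N ∣ (ℚ.<⇒≤ (h n N p ℕ.≤-refl)) ⟩
        1ℚ ℚ.+ ℚ.∣ x N ∣                   ∎
      where
      open ℚ.≤-Reasoning

    +-resp-∼ : ∀ {x x′ y y′} → x ∼ x′ → y ∼ y′ → (λ n → x n ℚ.+ y n) ∼ (λ n → x′ n ℚ.+ y′ n)
    +-resp-∼ {x} {x′} {y} {y′} s t = mk∼ (small-ext
      {f = λ m n → (x m ℚ.- x′ n) ℚ.+ (y m ℚ.- y′ n)}
      (λ m n → diff-+ (x m) (x′ n) (y m) (y′ n))
      (small-+ {f = λ m n → x m ℚ.- x′ n} {g = λ m n → y m ℚ.- y′ n} (s .close) (t .close)))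

    neg-resp-∼ : ∀ {x x′} → x ∼ x′ → (λ n → ℚ.- x n) ∼ (λ n → ℚ.- x′ n)
    neg-resp-∼ {x} {x′} s = mk∼ (small-ext
      {f = λ m n → ℚ.- (x m ℚ.- x′ n)}
      (λ m n → ℚ.neg-distrib-+ (x m) (ℚ.- x′ n))
      (small-neg {f = λ m n → x m ℚ.- x′ n} (s .close)))

    *-resp-∼ : ∀ {x x′ y y′} → x ∼ x′ → y ∼ y′ → (λ n → x n ℚ.* y n) ∼ (λ n → x′ n ℚ.* y′ n)
    *-resp-∼ {x} {x′} {y} {y′} s t =
      from-bounds (bounded (∼-trans s (∼-sym s))) (bounded (∼-trans (∼-sym t) t))
      where
      from-bounds : Bounded x → Bounded y′ → (λ n → x n ℚ.* y n) ∼ (λ n → x′ n ℚ.* y′ n)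
      from-bounds (B , 0<B , N , bx) (C , 0<C , M , by) = mk∼ (small-ext
        {f = λ m n → x m ℚ.* (y m ℚ.- y′ n) ℚ.+ y′ n ℚ.* (x m ℚ.- x′ n)}
        (λ m n → diff-* (x m) (x′ n) (y m) (y′ n))
        (small-+
          {f = λ m n → x m ℚ.* (y m ℚ.- y′ n)}
          {g = λ m n → y′ n ℚ.* (x m ℚ.- x′ n)}
          (small-* (λ m n → y m ℚ.- y′ n) (λ m _ → x m) B N 0<B (λ m _ p _ → bx m p) (t .close))
          (small-* (λ m n → x m ℚ.- x′ n) (λ _ n → y′ n) C M 0<C (λ _ n _ q → by n q) (s .close))))

    const-∼ : ∀ q → (λ _ → q) ∼ (λ _ → q)
    const-∼ q .close ε 0<ε = 0 , λ _ _ _ _ → subst (λ r → ℚ.∣ r ∣ ℚ.< ε) (sym (ℚ.+-inverseʳ q)) 0<ε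

    pointwise : ∀ (x y : ℝ) → (∀ n → seq x n ≡ seq y n) → x ≈ℝ y
    pointwise x y eq = mk≈ℝ (mk∼ (small-ext
      {f = λ m n → seq x m ℚ.- seq x n} (λ m n → cong (λ r → seq x m ℚ.- r) (eq n)) (cauchy x .close)))

infixl 6 _+ℝ_
infixl 7 _*ℝ_
infix  8 -ℝ_

_+ℝ_ _*ℝ_ : ℝ → ℝ → ℝ
mkℝ x cx +ℝ mkℝ y cy = mkℝ (λ n → x n ℚ.+ y n) (+-resp-∼ cx cy)
mkℝ x cx *ℝ mkℝ y cy = mkℝ (λ n → x n ℚ.* y n) (*-resp-∼ cx cy)

-ℝ_ : ℝ → ℝ
-ℝ mkℝ x cx = mkℝ (λ n → ℚ.- x n) (neg-resp-∼ cx)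

fromℚ : ℚ → ℝ
fromℚ q = mkℝ (λ _ → q) (const-∼ q)

0ℝ 1ℝ : ℝ
0ℝ = fromℚ 0ℚ
1ℝ = fromℚ 1ℚ

abstract

  ℝ-isCommutativeRing : IsCommutativeRing _≈ℝ_ _+ℝ_ _*ℝ_ -ℝ_ 0ℝ 1ℝ
  ℝ-isCommutativeRing = record
    { isRing = record
      { +-isAbelianGroup = record
        { isGroup = record
          { isMonoid = record
            { isSemigroup = record
              { isMagma = record
                { isEquivalence = record
                  { refl  = λ {x} → mk≈ℝ (cauchy x)
                  ; sym   = λ s → mk≈ℝ (∼-sym (seq-∼ s))
                  ; trans = λ s t → mk≈ℝ (∼-trans (seq-∼ s) (seq-∼ t))
                  }
                ; ∙-cong = λ s t → mk≈ℝ (+-resp-∼ (seq-∼ s) (seq-∼ t))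
                }
              ; assoc = λ x y z → pointwise ((x +ℝ y) +ℝ z) (x +ℝ (y +ℝ z)) (λ n → ℚ.+-assoc (seq x n) (seq y n) (seq z n))
              }
            ; identity = (λ x → pointwise (0ℝ +ℝ x) x (λ n → ℚ.+-identityˡ (seq x n)))
                       , (λ x → pointwise (x +ℝ 0ℝ) x (λ n → ℚ.+-identityʳ (seq x n)))
            }
          ; inverse = (λ x → pointwise ((-ℝ x) +ℝ x) 0ℝ (λ n → ℚ.+-inverseˡ (seq x n)))
                    , (λ x → pointwise (x +ℝ (-ℝ x)) 0ℝ (λ n → ℚ.+-inverseʳ (seq x n)))
          ; ⁻¹-cong = λ s → mk≈ℝ (neg-resp-∼ (seq-∼ s))
          }
        ; comm = λ x y → pointwise (x +ℝ y) (y +ℝ x) (λ n → ℚ.+-comm (seq x n) (seq y n))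
        }
      ; *-cong = λ s t → mk≈ℝ (*-resp-∼ (seq-∼ s) (seq-∼ t))
      ; *-assoc = λ x y z → pointwise ((x *ℝ y) *ℝ z) (x *ℝ (y *ℝ z)) (λ n → ℚ.*-assoc (seq x n) (seq y n) (seq z n))
      ; *-identity = (λ x → pointwise (1ℝ *ℝ x) x (λ n → ℚ.*-identityˡ (seq x n)))
                   , (λ x → pointwise (x *ℝ 1ℝ) x (λ n → ℚ.*-identityʳ (seq x n)))
      ; distrib = (λ x y z → pointwise (x *ℝ (y +ℝ z)) (x *ℝ y +ℝ x *ℝ z) (λ n → ℚ.*-distribˡ-+ (seq x n) (seq y n) (seq z n)))
                , (λ x y z → pointwise ((y +ℝ z) *ℝ x) (y *ℝ x +ℝ z *ℝ x) (λ n → ℚ.*-distribʳ-+ (seq x n) (seq y n) (seq z n)))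
      }
    ; *-comm = λ x y → pointwise (x *ℝ y) (y *ℝ x) (λ n → ℚ.*-comm (seq x n) (seq y n))
    }

ℝ-commutativeRing : CommutativeRing 0ℓ 0ℓ
ℝ-commutativeRing = record { isCommutativeRing = ℝ-isCommutativeRing }

------------------------------------------------------------------------
-- The ring R[i] with i² = -1

module AdjoinI {c ℓ} (R : CommutativeRing c ℓ) where

  private
    module R = CommutativeRing R

  infix 4 _≈_
  infixl 6 _+_
  infixl 7 _*_
  infix  8 -_

  record Complex : Set c where
    constructor _+i_
    field
      re im : R.Carrier

  open Complex public

  record _≈_ (z w : Complex) : Set ℓ where
    constructor mk≈
    field
      re-≈ : re z R.≈ re w
      im-≈ : im z R.≈ im w

  open _≈_ public

  _+_ _*_ : Complex → Complex → Complex
  (a +i b) + (c +i d) = (a R.+ c) +i (b R.+ d)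
  (a +i b) * (c +i d) = (a R.* c R.+ R.- (b R.* d)) +i (a R.* d R.+ b R.* c)

  -_ : Complex → Complex
  - (a +i b) = (R.- a) +i (R.- b)

  0# 1# : Complex
  0# = R.0# +i R.0#
  1# = R.1# +i R.0#

  private
    open RingProperties R.ring using (-‿distribˡ-*; -‿distribʳ-*; -‿+-comm; -0#≈0#)
    open CommutativeSemigroupProperties R.+-commutativeSemigroup using (interchange)
    open import Relation.Binary.Reasoning.Setoid R.setoid

    sub-* : ∀ x y z → (x R.+ R.- y) R.* z R.≈ x R.* z R.+ R.- (y R.* z)
    sub-* x y z = R.trans (R.distribʳ z x (R.- y)) (R.+-congˡ (R.sym (-‿distribˡ-* y z)))

    *-sub : ∀ x y z → x R.* (y R.+ R.- z) R.≈ x R.* y R.+ R.- (x R.* z)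
    *-sub x y z = R.trans (R.distribˡ x y (R.- z)) (R.+-congˡ (R.sym (-‿distribʳ-* x z)))

    neg-+ : ∀ x y → R.- (x R.+ y) R.≈ R.- x R.+ R.- y
    neg-+ x y = R.sym (-‿+-comm x y)

    assoc : ∀ z w v → (z * w) * v ≈ z * (w * v)
    assoc (a +i b) (c +i d) (e +i f) = mk≈
      (begin
        (a R.* c R.+ R.- (b R.* d)) R.* e R.+ R.- ((a R.* d R.+ b R.* c) R.* f)
          ≈⟨ R.+-cong (sub-* _ _ _) (R.-‿cong (R.distribʳ _ _ _)) ⟩
        (a R.* c R.* e R.+ R.- (b R.* d R.* e)) R.+ R.- (a R.* d R.* f R.+ b R.* c R.* f)
          ≈⟨ R.+-cong (R.+-cong (R.*-assoc a c e) (R.-‿cong (R.*-assoc b d e)))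
                      (R.-‿cong (R.+-cong (R.*-assoc a d f) (R.*-assoc b c f))) ⟩
        (a R.* (c R.* e) R.+ R.- (b R.* (d R.* e))) R.+ R.- (a R.* (d R.* f) R.+ b R.* (c R.* f))
          ≈⟨ R.+-congˡ (neg-+ _ _) ⟩
        (a R.* (c R.* e) R.+ R.- (b R.* (d R.* e))) R.+ (R.- (a R.* (d R.* f)) R.+ R.- (b R.* (c R.* f)))
          ≈⟨ interchange _ _ _ _ ⟩
        (a R.* (c R.* e) R.+ R.- (a R.* (d R.* f))) R.+ (R.- (b R.* (d R.* e)) R.+ R.- (b R.* (c R.* f)))
          ≈⟨ R.+-cong (R.sym (*-sub a _ _)) (R.+-comm _ _) ⟩
        a R.* (c R.* e R.+ R.- (d R.* f)) R.+ (R.- (b R.* (c R.* f)) R.+ R.- (b R.* (d R.* e)))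
          ≈⟨ R.+-congˡ (R.trans (-‿+-comm _ _) (R.-‿cong (R.sym (R.distribˡ b _ _)))) ⟩
        a R.* (c R.* e R.+ R.- (d R.* f)) R.+ R.- (b R.* (c R.* f R.+ d R.* e)) ∎)
      (begin
        (a R.* c R.+ R.- (b R.* d)) R.* f R.+ (a R.* d R.+ b R.* c) R.* e
          ≈⟨ R.+-cong (sub-* _ _ _) (R.distribʳ _ _ _) ⟩
        (a R.* c R.* f R.+ R.- (b R.* d R.* f)) R.+ (a R.* d R.* e R.+ b R.* c R.* e)
          ≈⟨ R.+-cong (R.+-cong (R.*-assoc a c f) (R.-‿cong (R.*-assoc b d f)))
                      (R.+-cong (R.*-assoc a d e) (R.*-assoc b c e)) ⟩
        (a R.* (c R.* f) R.+ R.- (b R.* (d R.* f))) R.+ (a R.* (d R.* e) R.+ b R.* (c R.* e))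
          ≈⟨ interchange _ _ _ _ ⟩
        (a R.* (c R.* f) R.+ a R.* (d R.* e)) R.+ (R.- (b R.* (d R.* f)) R.+ b R.* (c R.* e))
          ≈⟨ R.+-cong (R.sym (R.distribˡ a _ _)) (R.+-comm _ _) ⟩
        a R.* (c R.* f R.+ d R.* e) R.+ (b R.* (c R.* e) R.+ R.- (b R.* (d R.* f)))
          ≈⟨ R.+-congˡ (R.sym (*-sub b _ _)) ⟩
        a R.* (c R.* f R.+ d R.* e) R.+ b R.* (c R.* e R.+ R.- (d R.* f)) ∎)

    comm : ∀ z w → z * w ≈ w * z
    comm (a +i b) (c +i d) = mk≈
      (R.+-cong (R.*-comm a c) (R.-‿cong (R.*-comm b d)))
      (R.trans (R.+-comm _ _) (R.+-cong (R.*-comm b c) (R.*-comm a d)))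

    distribˡ : ∀ z w v → z * (w + v) ≈ z * w + z * v
    distribˡ (a +i b) (c +i d) (e +i f) = mk≈
      (begin
        a R.* (c R.+ e) R.+ R.- (b R.* (d R.+ f))
          ≈⟨ R.+-cong (R.distribˡ a c e) (R.trans (R.-‿cong (R.distribˡ b d f)) (neg-+ _ _)) ⟩
        (a R.* c R.+ a R.* e) R.+ (R.- (b R.* d) R.+ R.- (b R.* f))
          ≈⟨ interchange _ _ _ _ ⟩
        (a R.* c R.+ R.- (b R.* d)) R.+ (a R.* e R.+ R.- (b R.* f)) ∎)
      (begin
        a R.* (d R.+ f) R.+ b R.* (c R.+ e)
          ≈⟨ R.+-cong (R.distribˡ a d f) (R.distribˡ b c e) ⟩
        (a R.* d R.+ a R.* f) R.+ (b R.* c R.+ b R.* e)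
          ≈⟨ interchange _ _ _ _ ⟩
        (a R.* d R.+ b R.* c) R.+ (a R.* f R.+ b R.* e) ∎)

    identityˡ : ∀ z → 1# * z ≈ z
    identityˡ (a +i b) = mk≈
      (begin
        R.1# R.* a R.+ R.- (R.0# R.* b)  ≈⟨ R.+-cong (R.*-identityˡ a) (R.-‿cong (R.zeroˡ b)) ⟩
        a R.+ R.- R.0#                   ≈⟨ R.+-congˡ -0#≈0# ⟩
        a R.+ R.0#                       ≈⟨ R.+-identityʳ a ⟩
        a                                ∎)
      (begin
        R.1# R.* b R.+ R.0# R.* a  ≈⟨ R.+-cong (R.*-identityˡ b) (R.zeroˡ a) ⟩
        b R.+ R.0#                 ≈⟨ R.+-identityʳ b ⟩
        b                          ∎)

    isEquivalence : IsEquivalence _≈_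
    isEquivalence = record
      { refl  = mk≈ R.refl R.refl
      ; sym   = λ p → mk≈ (R.sym (re-≈ p)) (R.sym (im-≈ p))
      ; trans = λ p q → mk≈ (R.trans (re-≈ p) (re-≈ q)) (R.trans (im-≈ p) (im-≈ q))
      }

    open IsEquivalence isEquivalence using () renaming (trans to ≈-trans)

    +-cong : ∀ {z z′ w w′} → z ≈ z′ → w ≈ w′ → z + w ≈ z′ + w′
    +-cong p q = mk≈ (R.+-cong (re-≈ p) (re-≈ q)) (R.+-cong (im-≈ p) (im-≈ q))

    *-cong : ∀ {z z′ w w′} → z ≈ z′ → w ≈ w′ → z * w ≈ z′ * w′
    *-cong p q = mk≈
      (R.+-cong (R.*-cong (re-≈ p) (re-≈ q)) (R.-‿cong (R.*-cong (im-≈ p) (im-≈ q))))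
      (R.+-cong (R.*-cong (re-≈ p) (im-≈ q)) (R.*-cong (im-≈ p) (re-≈ q)))

  commutativeRing : CommutativeRing c ℓ
  commutativeRing = record
    { Carrier = Complex
    ; _≈_ = _≈_
    ; _+_ = _+_
    ; _*_ = _*_
    ; -_  = -_
    ; 0#  = 0#
    ; 1#  = 1#
    ; isCommutativeRing = record
      { isRing = record
        { +-isAbelianGroup = record
          { isGroup = record
            { isMonoid = record
              { isSemigroup = record
                { isMagma = record { isEquivalence = isEquivalence ; ∙-cong = +-cong }
                ; assoc = λ z w v → mk≈ (R.+-assoc (re z) (re w) (re v)) (R.+-assoc (im z) (im w) (im v))
                }
              ; identity = (λ z → mk≈ (R.+-identityˡ (re z)) (R.+-identityˡ (im z)))
                         , (λ z → mk≈ (R.+-identityʳ (re z)) (R.+-identityʳ (im z)))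
              }
            ; inverse = (λ z → mk≈ (R.-‿inverseˡ (re z)) (R.-‿inverseˡ (im z)))
                      , (λ z → mk≈ (R.-‿inverseʳ (re z)) (R.-‿inverseʳ (im z)))
            ; ⁻¹-cong = λ p → mk≈ (R.-‿cong (re-≈ p)) (R.-‿cong (im-≈ p))
            }
          ; comm = λ z w → mk≈ (R.+-comm (re z) (re w)) (R.+-comm (im z) (im w))
          }
        ; *-cong = *-cong
        ; *-assoc = assoc
        ; *-identity = identityˡ , λ z → ≈-trans (comm z 1#) (identityˡ z)
        ; distrib = distribˡ , λ z w v →
            ≈-trans (comm (w + v) z) (≈-trans (distribˡ z w v) (+-cong (comm z w) (comm z v)))
        }
      ; *-comm = comm
      }
    }

open AdjoinI ℝ-commutativeRing public using (re; im) renaming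
  ( Complex to ℂ; _+i_ to _+iℝ_; _≈_ to _≈ℂ_; _+_ to _+ℂ_; _*_ to _*ℂ_; -_ to -ℂ_
  ; 0# to 0ℂ; 1# to 1ℂ; commutativeRing to ℂ-commutativeRing )

-- z HasModulus r says that r is the nonnegative square root of re² + im².
record _HasModulus_ (z : ℂ) (r : ℝ) : Set where
  constructor mkModulus
  field
    nonnegative : 0≤ℝ r
    square      : r *ℝ r ≈ℝ re z *ℝ re z +ℝ im z *ℝ im z

𝕋 : Set
𝕋 = Σ ℂ (_HasModulus 1ℝ)

------------------------------------------------------------------------
-- Finite enumerations

allVecs : List A → ∀ k → List (Vec A k)
allVecs xs zero    = [ [] ]
allVecs xs (suc k) = cartesianProductWith _∷_ xs (allVecs xs k)

-- The members of xs satisfying P, each paired with one proof of P.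
witnesses : {P : Pred A p} → Decidable P → List A → List (Σ A P)
witnesses P? [] = []
witnesses P? (x ∷ xs) with P? x
... | yes px = (x , px) ∷ witnesses P? xs
... | no  _  = witnesses P? xs

------------------------------------------------------------------------
-- Determinants

-- A permutation σ of Fin n is given by its list of values
-- (σ 0 , … , σ (n - 1)), a vector without repetitions.
permutations : ∀ n → List (Vec (Fin n) n)
permutations n = filter (λ σ → unique? (toList σ)) (allVecs (allFin n) n)
  where open DecUnique Fin._≟_ using (unique?)

Inversion : Vec (Fin n) n → Fin n × Fin n → Set
Inversion σ (i , j) = i Fin.< j × lookup σ j Fin.< lookup σ i

inversions : Vec (Fin n) n → ℕ
inversions {n} σ = length (filter inversion? (cartesianProduct (allFin n) (allFin n)))
  where
  inversion? : Decidable (Inversion σ)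
  inversion? (i , j) = (i Fin.<? j) ×-dec (lookup σ j Fin.<? lookup σ i)

module _ {c ℓ} (R : CommutativeRing c ℓ) where
  open CommutativeRing R
  open SemiringExp semiring using (_^_)

  sumOver : List A → (A → Carrier) → Carrier
  sumOver xs f = foldr _+_ 0# (map f xs)

  productOver : List A → (A → Carrier) → Carrier
  productOver xs f = foldr _*_ 1# (map f xs)

  sign : ℕ → Carrier
  sign k = (- 1#) ^ k

  det : (Fin n → Fin n → Carrier) → Carrier
  det {n} M = sumOver (permutations n) λ σ →
    sign (inversions σ) * productOver (allFin n) (λ i → M i (lookup σ i))

------------------------------------------------------------------------
-- Digraphs

-- Row i is the set of out-neighbours of vertex i.
ArcSet : ℕ → Set
ArcSet n = Vec (Subset n) n

record Digraph (n : ℕ) : Set where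
  constructor mkDigraph
  field
    arcs     : ArcSet n
    loopless : ∀ i → i ∉ lookup arcs i

open Digraph public

Arc : Digraph n → Fin n → Fin n → Set
Arc D i j = j ∈ lookup (arcs D) i

outDegree inDegree : ArcSet n → Fin n → ℕ
outDegree B i = ∣ lookup B i ∣
inDegree  B j = ∣ Vec.map (λ N → lookup N j) B ∣

-- The gains are 𝕋-valued; no compatibility between opposite arcs is imposed.
Gain : Digraph n → Set
Gain {n} D = (i j : Fin n) → Arc D i j → 𝕋

adjacencyMatrix : (D : Digraph n) → Gain D → Fin n → Fin n → ℂ
adjacencyMatrix D φ i j with j ∈? lookup (arcs D) i
... | yes ij = proj₁ (φ i j ij)
... | no  _  = 0ℂ

------------------------------------------------------------------------
-- Directed cycles

-- Walk D u vs t: the sequence u, vs, t is a directed walk.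
Walk : Digraph n → Fin n → List (Fin n) → Fin n → Set
Walk D u []       t = Arc D u t
Walk D u (v ∷ vs) t = Arc D u v × Walk D v vs t

-- A directed cycle is determined by its vertex sequence up to rotation; the
-- rotation starting at the least vertex v is taken as its representative.
-- Length one is excluded because D has no loops.
IsCycle : Digraph n → Fin n × List (Fin n) → Set
IsCycle D (v , vs) = Unique (v ∷ vs) × All (v Fin.<_) vs × Walk D v vs v

Cycle : Digraph n → Set
Cycle D = Σ _ (IsCycle D)

walk? : (D : Digraph n) → ∀ u vs t → Dec (Walk D u vs t)
walk? D u []       t = t ∈? lookup (arcs D) u
walk? D u (v ∷ vs) t = (v ∈? lookup (arcs D) u) ×-dec walk? D v vs t

isCycle? : (D : Digraph n) → Decidable (IsCycle D)
isCycle? D (v , vs) = unique? (v ∷ vs) ×-dec all? (v Fin.<?_) vs ×-dec walk? D v vs v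
  where open DecUnique Fin._≟_ using (unique?)

-- The vertices of a cycle are distinct, so fewer than n of them follow v.
cycles : (D : Digraph n) → List (Cycle D)
cycles {n} D = witnesses (isCycle? D)
  (cartesianProduct (allFin n) (concatMap (λ k → map toList (allVecs (allFin n) k)) (upTo n)))

walkGain : (D : Digraph n) → Gain D → ∀ u vs t → Walk D u vs t → ℂ
walkGain D φ u []       t ut       = proj₁ (φ u t ut)
walkGain D φ u (v ∷ vs) t (uv , w) = proj₁ (φ u v uv) *ℂ walkGain D φ v vs t w

cycleGain : (D : Digraph n) → Gain D → Cycle D → ℂ
cycleGain D φ ((v , vs) , _ , _ , w) = walkGain D φ v vs v w

------------------------------------------------------------------------
-- Spanning elementary subdigraphs

IsSpanningElementary : Digraph n → ArcSet n → Set
IsSpanningElementary D B =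
  (∀ i → lookup B i ⊆ lookup (arcs D) i) ×
  (∀ i → outDegree B i ≡ 1) ×
  (∀ i → inDegree B i ≡ 1)

SpanningElementary : Digraph n → Set
SpanningElementary D = Σ _ (IsSpanningElementary D)

isSpanningElementary? : (D : Digraph n) → Decidable (IsSpanningElementary D)
isSpanningElementary? D B =
  Fin.all? (λ i → lookup B i ⊆? lookup (arcs D) i) ×-dec
  Fin.all? (λ i → outDegree B i ℕ.≟ 1) ×-dec
  Fin.all? (λ i → inDegree B i ℕ.≟ 1)

spanningElementaries : (D : Digraph n) → List (SpanningElementary D)
spanningElementaries {n} D = witnesses (isSpanningElementary? D)
  (allVecs (allVecs (inside ∷ outside ∷ []) n) n)

module _ (D : Digraph n) where

  subdigraph : SpanningElementary D → Digraph n
  subdigraph (B , B⊆D , _) = mkDigraph B (λ i → loopless D i ∘ B⊆D i)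

  restrictGain : (E : SpanningElementary D) → Gain D → Gain (subdigraph E)
  restrictGain (B , B⊆D , _) φ i j ij = φ i j (B⊆D i ij)

  -- The cycles composing E are exactly the directed cycles contained in E.
  -- They are vertex-disjoint, so there are at most n of them and n ∸ cycleCount E
  -- is a genuine difference.
  cycleCount : SpanningElementary D → ℕ
  cycleCount E = length (cycles (subdigraph E))

  elementaryGain : Gain D → SpanningElementary D → ℂ
  elementaryGain φ E =
    productOver ℂ-commutativeRing (cycles (subdigraph E)) (cycleGain (subdigraph E) (restrictGain E φ))

{-# OPTIONS --safe #-}

-- In the Leibniz expansion only the permutations σ with an arc from i to σ i for every i
-- contribute, and sending each vertex to its unique out-neighbour identifies the spanning
-- elementary subdigraphs with these permutations.  The cycles of E partition the vertices, so the
-- gain of E is the product of the entries (i , σ i).  For the sign, the cycle (v₀ v₁ … vₖ) is a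
-- product of k transpositions, each of which flips the parity of the number of inversions, and
-- these lengths k add up to n ∸ c(E).

module Submission where

open import Defs
open import Algebra.Bundles using (CommutativeMonoid; CommutativeRing)
import Algebra.Properties.Ring as RingProperties
open import Data.Fin.Base as Fin using (Fin; zero; suc)
open import Data.Fin.Permutation.Components using (transpose)
import Data.Fin.Properties as Fin
open import Data.Fin.Subset as Subset using (Subset; inside; outside; ⁅_⁆; ∣_∣)
import Data.Fin.Subset.Properties as Subset
open import Data.List.Base as List
  using (List; []; _∷_; _++_; map; foldr; filter; length; concatMap; allFin; cartesianProduct; tabulate; upTo)
import Data.List.Properties as List
open import Data.List.Membership.Propositional using (_∈_; _∉_)
open import Data.List.Membership.Propositional.Properties
open import Data.List.Membership.Propositional.Properties.WithK using (unique∧set⇒bag)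
open import Data.List.Relation.Binary.BagAndSetEquality using (∼bag⇒↭)
open import Data.List.Relation.Binary.Disjoint.Propositional using (Disjoint)
open import Data.List.Relation.Binary.Permutation.Propositional as Perm
  using (_↭_; prep; swap; ↭-refl; ↭-sym; ↭-trans; ↭⇒↭ₛ)
open import Data.List.Relation.Binary.Permutation.Propositional.Properties
  using (filter-↭; ↭-length; ++-comm; ∈-resp-↭)
import Data.List.Relation.Binary.Permutation.Setoid.Properties as PermSetoid
open import Data.List.Relation.Unary.All as All using (All; []; _∷_)
import Data.List.Relation.Unary.All.Properties as All
open import Data.List.Relation.Unary.AllPairs as AllPairs using (AllPairs; []; _∷_)
import Data.List.Relation.Unary.AllPairs.Properties as AllPairs
open import Data.List.Relation.Unary.Any using (here; there)
import Data.List.Relation.Unary.Unique.DecPropositional as DecUnique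
open import Data.List.Relation.Unary.Unique.Propositional using (Unique)
import Data.List.Relation.Unary.Unique.Propositional.Properties as Unique
open import Data.Nat.Base as ℕ using (ℕ; zero; suc; _+_; _∸_; _≤_; parity)
open import Data.Nat.ListAction using (sum)
import Data.Nat.Properties as ℕ
open import Data.Parity.Base as ℙ using (0ℙ; 1ℙ; _⁻¹)
import Data.Parity.Properties as ℙ
open import Data.Product.Base using (∃; _×_; _,_; proj₁; proj₂)
open import Data.Sum.Base using (_⊎_; inj₁; inj₂)
open import Data.Vec.Base as Vec using (Vec; []; _∷_; lookup; toList; fromList)
open import Data.Vec.Membership.Propositional.Properties
  using (∈-toList⁺) renaming (∈-lookup to ∈-lookupᵛ)
import Data.Vec.Properties as Vec
open import Data.Vec.Properties.WithK using ([]=-irrelevant)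
open import Function.Base using (_∘_; id; _on_)
open import Function.Bundles using (mk⇔)
open import Level using (Level)
open import Relation.Binary.Definitions using (tri<; tri≈; tri>)
open import Relation.Binary.PropositionalEquality
  using (_≡_; _≢_; _≗_; refl; sym; trans; cong; cong₂; subst; module ≡-Reasoning)
  renaming (setoid to ≡-setoid)
import Relation.Binary.Reasoning.Setoid as SetoidReasoning
open import Relation.Nullary using (¬_; Dec; yes; no; contradiction)
open import Relation.Nullary.Decidable using (dec-true; dec-false; _×-dec_)
open import Relation.Unary using (Pred; Decidable)

-- Multiplying a permutation on the left by a transposition changes its values and leaves the
-- positions alone. Permutations are therefore handled as lists of values: such a product is a
-- `map`, and inversions can be counted by recursion on the list. Signs are tracked as parities and
-- become powers of -1 only at the end.
--
-- `cycles` merely enumerates the candidates that pass a test, so it has to be proved that they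
-- partition the vertices. Every vertex lies on one by pigeonhole, and two that share a vertex are
-- equal because both are written from their common least vertex.
--
-- The enumerations pair their members with proofs. These are projected away, so that uniqueness and
-- membership concern plain data; duplicate-free lists with the same members are then rearrangements
-- of each other.

private
  variable
    a b p q : Level
    A : Set a
    B : Set b
    m n : ℕ

-- Inversions and transpositions

countBelow : Fin n → List (Fin n) → ℕ
countBelow x xs = length (filter (Fin._<? x) xs)

listInversions : List (Fin n) → ℕ
listInversions []       = 0
listInversions (x ∷ xs) = countBelow x xs + listInversions xs

infix 4 _⇄_
-- The rearrangement is recorded next to the parity because `⇄-cons` depends on it: the number of
-- later entries below a new head is unchanged only if the tail keeps its members.
_⇄_ : List (Fin n) → List (Fin n) → Set
xs ⇄ ys = xs ↭ ys × parity (listInversions xs) ≡ parity (listInversions ys) ⁻¹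

parity-suc : ∀ k → parity (suc k) ≡ parity k ⁻¹
parity-suc k = trans (sym (ℙ.⁻¹-involutive _)) (cong _⁻¹ (ℙ.suc-homo-⁻¹ k))

⇄-cons : ∀ (x : Fin n) {xs ys} → xs ⇄ ys → x ∷ xs ⇄ x ∷ ys
⇄-cons x {xs} {ys} (xs↭ys , flip) = prep x xs↭ys , (begin
  parity (countBelow x xs + listInversions xs)            ≡⟨ ℙ.+-homo-+ (countBelow x xs) _ ⟩
  parity (countBelow x xs) ℙ.+ parity (listInversions xs) ≡⟨ cong₂ (λ k → parity k ℙ.+_) (↭-length (filter-↭ _ xs↭ys)) flip ⟩
  parity (countBelow x ys) ℙ.+ parity (listInversions ys) ⁻¹ ≡⟨ +-⁻¹ (parity (countBelow x ys)) _ ⟩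
  (parity (countBelow x ys) ℙ.+ parity (listInversions ys)) ⁻¹ ≡⟨ cong _⁻¹ (sym (ℙ.+-homo-+ (countBelow x ys) _)) ⟩
  parity (listInversions (x ∷ ys)) ⁻¹ ∎)
  where
  open ≡-Reasoning
  +-⁻¹ : ∀ u v → u ℙ.+ v ⁻¹ ≡ (u ℙ.+ v) ⁻¹
  +-⁻¹ 0ℙ v = refl
  +-⁻¹ 1ℙ v = refl

⇄-++ : ∀ (ws : List (Fin n)) {xs ys} → xs ⇄ ys → ws ++ xs ⇄ ws ++ ys
⇄-++ []       s = s
⇄-++ (w ∷ ws) s = ⇄-cons w (⇄-++ ws s)

-- Two flips cancel, so the relation composes only along an odd number of steps.
⇄-trans³ : ∀ {ws xs ys zs : List (Fin n)} → ws ⇄ xs → xs ⇄ ys → ys ⇄ zs → ws ⇄ zs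
⇄-trans³ (p , f) (q , g) (r , h) =
  ↭-trans p (↭-trans q r) , trans f (cong _⁻¹ (trans g (trans (cong _⁻¹ h) (ℙ.⁻¹-involutive _))))

-- The counts of `x` and `y` against `zs` are added in the other order; only the pair itself
-- changes, by exactly one inversion.
⇄-swap : ∀ {x y : Fin n} zs → x ≢ y → x ∷ y ∷ zs ⇄ y ∷ x ∷ zs
⇄-swap {x = x} {y} zs x≢y = swap x y ↭-refl , flip
  where
  ordered : ∀ {x y} → x Fin.< y → listInversions (y ∷ x ∷ zs) ≡ suc (listInversions (x ∷ y ∷ zs))
  ordered {x} {y} x<y = begin
    length (filter (Fin._<? y) (x ∷ zs)) + (countBelow x zs + listInversions zs)
      ≡⟨ cong (λ l → length l + (countBelow x zs + listInversions zs)) (List.filter-accept (Fin._<? y) x<y) ⟩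
    suc (countBelow y zs + (countBelow x zs + listInversions zs))
      ≡⟨ cong suc (ℕ.+-assoc (countBelow y zs) _ _) ⟨
    suc (countBelow y zs + countBelow x zs + listInversions zs)
      ≡⟨ cong (λ k → suc (k + listInversions zs)) (ℕ.+-comm (countBelow y zs) (countBelow x zs)) ⟩
    suc (countBelow x zs + countBelow y zs + listInversions zs)
      ≡⟨ cong suc (ℕ.+-assoc (countBelow x zs) _ _) ⟩
    suc (countBelow x zs + (countBelow y zs + listInversions zs))
      ≡⟨ cong (λ l → suc (length l + (countBelow y zs + listInversions zs))) (List.filter-reject (Fin._<? x) (Fin.<-asym x<y)) ⟨
    suc (listInversions (x ∷ y ∷ zs)) ∎
    where open ≡-Reasoning
  flip : parity (listInversions (x ∷ y ∷ zs)) ≡ parity (listInversions (y ∷ x ∷ zs)) ⁻¹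
  flip with Fin.<-cmp x y
  ... | tri< x<y _ _ = trans (sym (ℙ.suc-homo-⁻¹ (listInversions (x ∷ y ∷ zs)))) (cong (_⁻¹ ∘ parity) (sym (ordered x<y)))
  ... | tri≈ _ x≡y _ = contradiction x≡y x≢y
  ... | tri> _ _ y<x = trans (cong parity (ordered y<x)) (parity-suc (listInversions (y ∷ x ∷ zs)))

-- The first entry `w` of the stretch is swapped out to the front, the exchange happens behind it,
-- and `w` is swapped back in: two swaps around one flip, so the total stays odd.
⇄-exchange : ∀ {x y : Fin n} ys zs → x ≢ y → All (x ≢_) ys → All (y ≢_) ys →
             x ∷ ys ++ y ∷ zs ⇄ y ∷ ys ++ x ∷ zs
⇄-exchange []       zs x≢y []          []          = ⇄-swap zs x≢y
⇄-exchange (w ∷ ys) zs x≢y (x≢w ∷ x≢ys) (y≢w ∷ y≢ys) = ⇄-trans³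
  (⇄-swap _ x≢w)
  (⇄-cons w (⇄-exchange ys zs x≢y x≢ys y≢ys))
  (⇄-swap _ (y≢w ∘ sym))

-- Transpositions acting on the values of a list

transpose-left : ∀ (x y : Fin n) → transpose x y x ≡ y
transpose-left x y rewrite dec-true (x Fin.≟ x) refl = refl

transpose-right : ∀ (x y : Fin n) → transpose x y y ≡ x
transpose-right x y with y Fin.≟ x
... | yes y≡x = y≡x
... | no  _ rewrite dec-true (y Fin.≟ y) refl = refl

transpose-other : ∀ {x y z : Fin n} → z ≢ x → z ≢ y → transpose x y z ≡ z
transpose-other {x = x} {y} {z} z≢x z≢y
  rewrite dec-false (z Fin.≟ x) z≢x | dec-false (z Fin.≟ y) z≢y = refl

transpose-comm : ∀ (x y : Fin n) → transpose x y ≗ transpose y x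
transpose-comm x y z = by-cases (z Fin.≟ x) (z Fin.≟ y)
  where
  by-cases : Dec (z ≡ x) → Dec (z ≡ y) → transpose x y z ≡ transpose y x z
  by-cases (yes refl) _          = trans (transpose-left x y) (sym (transpose-right y x))
  by-cases (no _)     (yes refl) = trans (transpose-right x y) (sym (transpose-left y x))
  by-cases (no z≢x)   (no z≢y)   = trans (transpose-other z≢x z≢y) (sym (transpose-other z≢y z≢x))

All-≢ : ∀ {x : A} {xs} → x ∉ xs → All (x ≢_) xs
All-≢ = All.¬Any⇒All¬ _

map-fixed : {f : A → A} {xs : List A} → (∀ {x} → x ∈ xs → f x ≡ x) → map f xs ≡ xs
map-fixed fixed = List.map-id-local (All.tabulate fixed)

unique-middle : ∀ xs {x : A} {ys} → Unique (xs ++ x ∷ ys) → x ∉ xs × x ∉ ys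
unique-middle []       (x∉ys ∷ _)       = (λ ()) , All.All¬⇒¬Any x∉ys
unique-middle (w ∷ xs) (w∉ ∷ unique) with unique-middle xs unique
... | x∉xs , x∉ys = (λ { (here refl) → All.head (All.++⁻ʳ xs w∉) refl ; (there x∈xs) → x∉xs x∈xs }) , x∉ys

-- In a list without repetitions, interchanging two values amounts to exchanging the two positions
-- that hold them.
transpose-head-⇄ : ∀ {x y : Fin n} {xs} → Unique (x ∷ xs) → y ∈ xs → x ≢ y →
                   map (transpose x y) (x ∷ xs) ⇄ x ∷ xs
transpose-head-⇄ {x = x} {y} (x≢ ∷ unique) y∈xs x≢y with ∈-∃++ y∈xs
... | ys , zs , refl = subst (_⇄ x ∷ ys ++ y ∷ zs) (sym mapped)
        (⇄-exchange ys zs (x≢y ∘ sym) (All-≢ y∉ys) (All.++⁻ˡ ys x≢))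
  where
  y∉ys = proj₁ (unique-middle ys unique)
  y∉zs = proj₂ (unique-middle ys unique)
  fixes : ∀ {ws} → x ∉ ws → y ∉ ws → map (transpose x y) ws ≡ ws
  fixes x∉ y∉ = map-fixed λ z∈ →
    transpose-other (λ z≡x → x∉ (subst (_∈ _) z≡x z∈)) (λ z≡y → y∉ (subst (_∈ _) z≡y z∈))
  mapped : map (transpose x y) (x ∷ ys ++ y ∷ zs) ≡ y ∷ ys ++ x ∷ zs
  mapped = cong₂ _∷_ (transpose-left x y) (trans (List.map-++ _ ys (y ∷ zs))
    (cong₂ _++_ (fixes (All.All¬⇒¬Any (All.++⁻ˡ ys x≢)) y∉ys)
      (cong₂ _∷_ (transpose-right x y) (fixes (All.All¬⇒¬Any (All.tail (All.++⁻ʳ ys x≢))) y∉zs))))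

transpose-⇄ : ∀ {x y : Fin n} {xs} → Unique xs → x ∈ xs → y ∈ xs → x ≢ y → map (transpose x y) xs ⇄ xs
transpose-⇄ _      (here refl)  (here refl)  x≢y = contradiction refl x≢y
transpose-⇄ unique (here refl)  (there y∈xs) x≢y = transpose-head-⇄ unique y∈xs x≢y
transpose-⇄ {x = x} {y} {xs} unique (there x∈xs) (here refl) x≢y =
  subst (_⇄ xs) (List.map-cong (transpose-comm y x) xs) (transpose-head-⇄ unique x∈xs (x≢y ∘ sym))
transpose-⇄ {x = x} {y} {w ∷ xs} (w≢ ∷ unique) (there x∈xs) (there y∈xs) x≢y =
  subst (λ v → v ∷ map (transpose x y) xs ⇄ w ∷ xs)
    (sym (transpose-other (All.lookup w≢ x∈xs) (All.lookup w≢ y∈xs)))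
    (⇄-cons w (transpose-⇄ unique x∈xs y∈xs x≢y))

-- Inversions of a function and of its list of values

length-filter-++ : ∀ {P : Pred A p} (P? : Decidable P) xs ys →
                   length (filter P? (xs ++ ys)) ≡ length (filter P? xs) + length (filter P? ys)
length-filter-++ P? xs ys = trans (cong length (List.filter-++ P? xs ys)) (List.length-++ (filter P? xs))

length-filter-map : ∀ {P : Pred B p} {Q : Pred A q} (P? : Decidable P) (Q? : Decidable Q) (f : A → B) xs →
                    (∀ x → P (f x) → Q x) → (∀ x → Q x → P (f x)) →
                    length (filter P? (map f xs)) ≡ length (filter Q? xs)
length-filter-map P? Q? f []       P⇒Q Q⇒P = refl
length-filter-map P? Q? f (x ∷ xs) P⇒Q Q⇒P with P? (f x) | Q? x
... | yes _ | yes _ = cong suc (length-filter-map P? Q? f xs P⇒Q Q⇒P)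
... | no  _ | no  _ = length-filter-map P? Q? f xs P⇒Q Q⇒P
... | yes p | no ¬q = contradiction (P⇒Q x p) ¬q
... | no ¬p | yes q = contradiction (Q⇒P x q) ¬p

-- The count behind `inversions`, with domain and codomain separated: removing the index `zero`
-- shrinks the domain but not the codomain, so the induction leaves the permutations of a single
-- `Fin n`.
functionInversions : (Fin m → Fin n) → List (Fin m × Fin m) → ℕ
functionInversions f ijs = length (filter (λ (i , j) → (i Fin.<? j) ×-dec (f j Fin.<? f i)) ijs)

functionInversions-++ : (f : Fin m → Fin n) → ∀ ijs kls →
  functionInversions f (ijs ++ kls) ≡ functionInversions f ijs + functionInversions f kls
functionInversions-++ f = length-filter-++ _

functionInversions-row : (f : Fin (suc m) → Fin n) → ∀ is js →
  functionInversions f (cartesianProduct (map suc is) (zero ∷ map suc js))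
    ≡ functionInversions (f ∘ suc) (cartesianProduct is js)
functionInversions-row f []       js = refl
functionInversions-row f (i ∷ is) js = begin
  functionInversions f (row ++ rows)
    ≡⟨ functionInversions-++ f row rows ⟩
  -- The pair `(suc i , zero)` has disappeared by computation, as `suc i` is never below `zero`.
  functionInversions f (map (suc i ,_) (map suc js)) + functionInversions f rows
    ≡⟨ cong₂ (λ l k → functionInversions f l + k) (List.map-∘ js) refl ⟨
  functionInversions f (map (λ j → suc i , suc j) js) + functionInversions f rows
    ≡⟨ cong₂ _+_
         (trans (length-filter-map _ (λ j → (i Fin.<? j) ×-dec (f (suc j) Fin.<? f (suc i))) _ js
                  (λ { _ (ℕ.s<s i<j , lt) → i<j , lt }) (λ { _ (i<j , lt) → ℕ.s<s i<j , lt }))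
           (sym (length-filter-map _ _ _ js (λ _ → id) (λ _ → id))))
         (functionInversions-row f is js) ⟩
  functionInversions (f ∘ suc) (map (i ,_) js) + functionInversions (f ∘ suc) (cartesianProduct is js)
    ≡⟨ functionInversions-++ (f ∘ suc) (map (i ,_) js) _ ⟨
  functionInversions (f ∘ suc) (map (i ,_) js ++ cartesianProduct is js) ∎
  where
  open ≡-Reasoning
  row = map (suc i ,_) (zero ∷ map suc js)
  rows = cartesianProduct (map suc is) (zero ∷ map suc js)

allFin-suc : ∀ n → allFin (suc n) ≡ zero ∷ map suc (allFin n)
allFin-suc n = cong (zero ∷_) (sym (List.map-tabulate id suc))

-- The index `zero` precedes all others, so its row counts the later values below `f zero`, while
-- its column contributes nothing.
functionInversions-list : ∀ m (f : Fin m → Fin n) →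
  functionInversions f (cartesianProduct (allFin m) (allFin m)) ≡ listInversions (map f (allFin m))
functionInversions-list zero    f = refl
functionInversions-list (suc m) f = begin
  functionInversions f (cartesianProduct (allFin (suc m)) (allFin (suc m)))
    ≡⟨ cong (λ is → functionInversions f (cartesianProduct is is)) (allFin-suc m) ⟩
  functionInversions f (map (zero ,_) (map suc is) ++ rows)
    ≡⟨ functionInversions-++ f (map (zero ,_) (map suc is)) rows ⟩
  functionInversions f (map (zero ,_) (map suc is)) + functionInversions f rows
    ≡⟨ cong₂ _+_ first-row (functionInversions-row f is is) ⟩
  countBelow (f zero) (map (f ∘ suc) is) + functionInversions (f ∘ suc) (cartesianProduct is is)
    ≡⟨ cong (countBelow (f zero) (map (f ∘ suc) is) +_) (functionInversions-list m (f ∘ suc)) ⟩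
  listInversions (f zero ∷ map (f ∘ suc) is)
    ≡⟨ cong (λ l → listInversions (f zero ∷ l)) (List.map-∘ is) ⟩
  listInversions (map f (zero ∷ map suc is))
    ≡⟨ cong (listInversions ∘ map f) (allFin-suc m) ⟨
  listInversions (map f (allFin (suc m))) ∎
  where
  open ≡-Reasoning
  is = allFin m
  rows = cartesianProduct (map suc is) (zero ∷ map suc is)
  first-row : functionInversions f (map (zero ,_) (map suc is)) ≡ countBelow (f zero) (map (f ∘ suc) is)
  first-row = trans
    (trans (cong (functionInversions f) (sym (List.map-∘ is)))
      (length-filter-map _ (λ j → f (suc j) Fin.<? f zero) _ is (λ _ → proj₂) (λ _ lt → ℕ.z<s , lt)))
    (sym (length-filter-map _ _ _ is (λ _ → id) (λ _ → id)))

inversions-list : (σ : Vec (Fin n) n) → inversions σ ≡ listInversions (map (lookup σ) (allFin n))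
inversions-list {n} σ = functionInversions-list n (lookup σ)

listInversions-allFin : ∀ n → listInversions (allFin n) ≡ 0
listInversions-allFin n = begin
  listInversions (allFin n)          ≡⟨ cong listInversions (List.map-id (allFin n)) ⟨
  listInversions (map id (allFin n)) ≡⟨ functionInversions-list n id ⟨
  functionInversions id (cartesianProduct (allFin n) (allFin n))
    ≡⟨ cong length (List.filter-none _ (All.universal (λ _ (i<j , j<i) → Fin.<-asym i<j j<i) (cartesianProduct (allFin n) (allFin n)))) ⟩
  0 ∎
  where open ≡-Reasoning

-- Finite enumerations

unique-resp-↭ : {xs ys : List A} → xs ↭ ys → Unique xs → Unique ys
unique-resp-↭ xs↭ys = PermSetoid.Unique-resp-↭ (≡-setoid _) (↭⇒↭ₛ xs↭ys)

-- Reduces each reordering of a sum or product below to two inclusions and the absence of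
-- repetitions.
unique-↭ : {xs ys : List A} → Unique xs → Unique ys →
           (∀ {x} → x ∈ xs → x ∈ ys) → (∀ {x} → x ∈ ys → x ∈ xs) → xs ↭ ys
unique-↭ xs! ys! xs⊆ys ys⊆xs = ∼bag⇒↭ (unique∧set⇒bag xs! ys! (mk⇔ xs⊆ys ys⊆xs))

unique-++⁻ : ∀ (xs : List A) {ys} → Unique (xs ++ ys) → Disjoint xs ys × Unique ys
unique-++⁻ []       ys! = (λ ()) , ys!
unique-++⁻ (x ∷ xs) (x∉ ∷ xs++ys!) with unique-++⁻ xs xs++ys!
... | disjoint , ys! =
  (λ { (here refl , v∈ys) → All.lookup (All.++⁻ʳ xs x∉) v∈ys refl ; (there v∈xs , v∈ys) → disjoint (v∈xs , v∈ys) }) , ys!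

-- Pigeonhole: distinct entries make the positions inject into `Fin n`.
unique-length : {xs : List (Fin n)} → Unique xs → length xs ≤ n
unique-length {xs = xs} xs! = Fin.injective⇒≤ (lookup-injective xs! _ _)
  where
  lookup-injective : ∀ {xs : List (Fin n)} → Unique xs → ∀ i j → List.lookup xs i ≡ List.lookup xs j → i ≡ j
  lookup-injective (x∉ ∷ xs!) zero    zero    eq = refl
  lookup-injective (x∉ ∷ xs!) zero    (suc j) eq = contradiction eq (All.lookup x∉ (∈-lookup j))
  lookup-injective (x∉ ∷ xs!) (suc i) zero    eq = contradiction (sym eq) (All.lookup x∉ (∈-lookup i))
  lookup-injective (x∉ ∷ xs!) (suc i) (suc j) eq = cong suc (lookup-injective xs! i j eq)

∈-allVecs : {xs : List A} → (∀ x → x ∈ xs) → ∀ {k} (v : Vec A k) → v ∈ allVecs xs k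
∈-allVecs x∈xs []      = here refl
∈-allVecs x∈xs (x ∷ v) = ∈-cartesianProductWith⁺ _∷_ (x∈xs x) (∈-allVecs x∈xs v)

allVecs-unique : {xs : List A} → Unique xs → ∀ k → Unique (allVecs xs k)
allVecs-unique xs! zero    = [] ∷ []
allVecs-unique xs! (suc k) =
  Unique.cartesianProductWith⁺ _∷_ Vec.∷-injective xs! (allVecs-unique xs! k)

map-proj₁-witnesses : {P : Pred A p} (P? : Decidable P) → ∀ xs → map proj₁ (witnesses P? xs) ≡ filter P? xs
map-proj₁-witnesses P? []       = refl
map-proj₁-witnesses P? (x ∷ xs) with P? x
... | yes _ = cong (x ∷_) (map-proj₁-witnesses P? xs)
... | no  _ = map-proj₁-witnesses P? xs

minimum : ∀ (x : Fin n) xs → ∃ λ m → m ∈ x ∷ xs × (∀ {y} → y ∈ x ∷ xs → m Fin.≤ y)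
minimum x []       = x , here refl , λ { (here refl) → Fin.≤-refl }
minimum x (y ∷ xs) with minimum y xs
... | m , m∈ , m≤ with Fin.≤-total x m
...   | inj₁ x≤m = x , here refl , λ { (here refl) → Fin.≤-refl ; (there z∈) → Fin.≤-trans x≤m (m≤ z∈) }
...   | inj₂ m≤x = m , there m∈ , λ { (here refl) → m≤x ; (there z∈) → m≤ z∈ }

-- Cycles of a digraph

vertices : Fin n × List (Fin n) → List (Fin n)
vertices (v , vs) = v ∷ vs

-- The product (v₀ v₁)(v₁ v₂)...(vₖ₋₁ vₖ) with the rightmost factor acting first: vᵢ goes to vᵢ₊₁,
-- and vₖ is carried through all factors back to v₀.
cyclePermutation : Fin n → List (Fin n) → Fin n → Fin n
cyclePermutation v []       = id
cyclePermutation v (w ∷ ws) = transpose v w ∘ cyclePermutation w ws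

cyclesPermutation : List (Fin n × List (Fin n)) → Fin n → Fin n
cyclesPermutation []              = id
cyclesPermutation ((v , vs) ∷ cs) = cyclePermutation v vs ∘ cyclesPermutation cs

cyclePermutation-outside : ∀ (v : Fin n) vs {x} → x ∉ v ∷ vs → cyclePermutation v vs x ≡ x
cyclePermutation-outside v []       x∉ = refl
cyclePermutation-outside v (w ∷ ws) x∉ =
  trans (cong (transpose v w) (cyclePermutation-outside w ws (x∉ ∘ there)))
    (transpose-other (x∉ ∘ here) (x∉ ∘ there ∘ here))

cyclesPermutation-outside : ∀ (cs : List (Fin n × List (Fin n))) {x} →
                            x ∉ concatMap vertices cs → cyclesPermutation cs x ≡ x
cyclesPermutation-outside []              x∉ = refl
cyclesPermutation-outside ((v , vs) ∷ cs) x∉ =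
  trans (cong (cyclePermutation v vs) (cyclesPermutation-outside cs (x∉ ∘ ∈-++⁺ʳ (v ∷ vs))))
    (cyclePermutation-outside v vs (x∉ ∘ ∈-++⁺ˡ))

transpositions : List (Fin n × List (Fin n)) → ℕ
transpositions = sum ∘ map (length ∘ proj₂)

length-vertices : (cs : List (Fin n × List (Fin n))) →
                  length (concatMap vertices cs) ≡ transpositions cs + length cs
length-vertices []              = refl
length-vertices ((v , vs) ∷ cs) = begin
  suc (length (vs ++ concatMap vertices cs))           ≡⟨ cong suc (List.length-++ vs) ⟩
  suc (length vs + length (concatMap vertices cs))     ≡⟨ cong (λ k → suc (length vs + k)) (length-vertices cs) ⟩
  suc (length vs + (transpositions cs + length cs))    ≡⟨ cong suc (ℕ.+-assoc (length vs) _ _) ⟨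
  suc (length vs + transpositions cs + length cs)      ≡⟨ ℕ.+-suc _ _ ⟨
  length vs + transpositions cs + suc (length cs)      ∎
  where open ≡-Reasoning

-- The values are kept a rearrangement of `allFin n` throughout, since this provides the
-- distinctness and the two memberships that `transpose-⇄` needs at the next factor.
cyclePermutation-parity : ∀ {xs : List (Fin n)} → xs ↭ allFin n → ∀ v vs → Unique (v ∷ vs) →
  map (cyclePermutation v vs) xs ↭ allFin n ×
  parity (listInversions (map (cyclePermutation v vs) xs)) ≡ parity (length vs + listInversions xs)
cyclePermutation-parity {n} {xs} xs↭ v []       _ =
  subst (_↭ allFin n) (sym (List.map-id xs)) xs↭ , cong (parity ∘ listInversions) (List.map-id xs)
cyclePermutation-parity {n} {xs} xs↭ v (w ∷ ws) ((v≢w ∷ _) ∷ w∷ws!)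
  with cyclePermutation-parity xs↭ w ws w∷ws!
... | ys↭ , eq with transpose-⇄ (unique-resp-↭ (↭-sym ys↭) (Unique.allFin⁺ n))
                      (∈-resp-↭ (↭-sym ys↭) (∈-allFin v)) (∈-resp-↭ (↭-sym ys↭) (∈-allFin w)) v≢w
...   | zs↭ys , flip =
  subst (_↭ allFin n) (sym (List.map-∘ xs)) (↭-trans zs↭ys ys↭) ,
  (begin
    parity (listInversions (map (transpose v w ∘ cyclePermutation w ws) xs))
      ≡⟨ cong (parity ∘ listInversions) (List.map-∘ xs) ⟩
    parity (listInversions (map (transpose v w) (map (cyclePermutation w ws) xs)))
      ≡⟨ flip ⟩
    parity (listInversions (map (cyclePermutation w ws) xs)) ℙ.⁻¹
      ≡⟨ cong ℙ._⁻¹ eq ⟩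
    parity (length ws + listInversions xs) ℙ.⁻¹
      ≡⟨ parity-suc (length ws + listInversions xs) ⟨
    parity (suc (length ws) + listInversions xs) ∎)
  where open ≡-Reasoning

cyclesPermutation-parity : (cs : List (Fin n × List (Fin n))) → All (Unique ∘ vertices) cs →
  map (cyclesPermutation cs) (allFin n) ↭ allFin n ×
  parity (listInversions (map (cyclesPermutation cs) (allFin n))) ≡ parity (transpositions cs)
cyclesPermutation-parity {n} [] [] rewrite List.map-id (allFin n) =
  ↭-refl , cong parity (listInversions-allFin n)
cyclesPermutation-parity {n} ((v , vs) ∷ cs) (c! ∷ cs!)
  with cyclesPermutation-parity cs cs!
... | xs↭ , eq with cyclePermutation-parity xs↭ v vs c!
...   | ys↭ , eq′ rewrite List.map-∘ {g = cyclePermutation v vs} {f = cyclesPermutation cs} (allFin n) =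
  ys↭ , (begin
    parity (listInversions (map (cyclePermutation v vs) xs))  ≡⟨ eq′ ⟩
    parity (length vs + listInversions xs)                       ≡⟨ ℙ.+-homo-+ (length vs) _ ⟩
    parity (length vs) ℙ.+ parity (listInversions xs)            ≡⟨ cong (parity (length vs) ℙ.+_) eq ⟩
    parity (length vs) ℙ.+ parity (transpositions cs)            ≡⟨ ℙ.+-homo-+ (length vs) _ ⟨
    parity (length vs + transpositions cs)                       ∎)
  where
  open ≡-Reasoning
  xs = map (cyclesPermutation cs) (allFin n)

-- The enumeration of cycle candidates

cycleCandidates : ∀ n → List (Fin n × List (Fin n))
cycleCandidates n = cartesianProduct (allFin n) (concatMap (λ k → map toList (allVecs (allFin n) k)) (upTo n))

-- Tails from different blocks differ in length, and tails within one block come from different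
-- vectors.
cycleCandidates-unique : ∀ n → Unique (cycleCandidates n)
cycleCandidates-unique n = Unique.cartesianProduct⁺ (Unique.allFin⁺ n) (Unique.concat⁺
  (All.map⁺ (All.universal (λ k → Unique.map⁺ (toList-inj k) (allVecs-unique (Unique.allFin⁺ n) k)) (upTo n)))
  (AllPairs.map⁺ (AllPairs.map disjoint (Unique.upTo⁺ n))))
  where
  toList-inj : ∀ k {v w : Vec (Fin n) k} → toList v ≡ toList w → v ≡ w
  toList-inj k {v} {w} eq = trans (sym (Vec.cast-is-id refl v)) (Vec.toList-injective refl v w eq)
  length-member : ∀ {k vs} → vs ∈ map toList (allVecs (allFin n) k) → length vs ≡ k
  length-member vs∈ with ∈-map⁻ toList vs∈
  ... | v , _ , refl = Vec.length-toList v
  disjoint : ∀ {j k} → j ≢ k → Disjoint (map toList (allVecs (allFin n) j)) (map toList (allVecs (allFin n) k))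
  disjoint j≢k (v∈j , v∈k) = j≢k (trans (sym (length-member v∈j)) (length-member v∈k))

∈-cycleCandidates : ∀ {v : Fin n} {vs} → Unique (v ∷ vs) → (v , vs) ∈ cycleCandidates n
∈-cycleCandidates {n} {v} {vs} c! = ∈-cartesianProduct⁺ (∈-allFin v)
  (∈-concat⁺′ (subst (_∈ map toList (allVecs (allFin n) (length vs))) (Vec.toList∘fromList vs) (∈-map⁺ toList (∈-allVecs ∈-allFin (fromList vs))))
    -- `unique-length` bounds the length of `v ∷ vs`, which is the strict bound on `length vs` that
    -- `upTo n` requires.
    (∈-map⁺ (λ k → map toList (allVecs (allFin n) k)) (∈-upTo⁺ (unique-length c!))))

module _ (D : Digraph n) where

  underlyingCycles : List (Fin n × List (Fin n))
  underlyingCycles = map proj₁ (cycles D)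

  private
    underlyingCycles-filter : underlyingCycles ≡ filter (isCycle? D) (cycleCandidates n)
    underlyingCycles-filter = map-proj₁-witnesses (isCycle? D) (cycleCandidates n)

  underlyingCycles-unique : Unique underlyingCycles
  underlyingCycles-unique = subst Unique (sym underlyingCycles-filter)
    (Unique.filter⁺ (isCycle? D) (cycleCandidates-unique n))

  ∈-underlyingCycles⁺ : ∀ {c} → IsCycle D c → c ∈ underlyingCycles
  ∈-underlyingCycles⁺ {c} isCycle@(c! , _) = subst (c ∈_) (sym underlyingCycles-filter)
    (∈-filter⁺ (isCycle? D) (∈-cycleCandidates c!) isCycle)

  underlyingCycles-isCycle : All (IsCycle D) underlyingCycles
  underlyingCycles-isCycle = All.map⁺ (All.universal proj₂ (cycles D))

  walk-split : ∀ {u t} us {v vs} → Walk D u (us ++ v ∷ vs) t → Walk D u us v × Walk D v vs t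
  walk-split []       (uv , vt) = uv , vt
  walk-split (_ ∷ us) (uw , wt) with walk-split us wt
  ... | wv , vt = (uw , wv) , vt

  walk-join : ∀ {u t} us {v vs} → Walk D u us v → Walk D v vs t → Walk D u (us ++ v ∷ vs) t
  walk-join []       uv        vt = uv , vt
  walk-join (_ ∷ us) (uw , wv) vt = uw , walk-join us wv vt

  -- A closed path becomes a cycle in normal form once it is rotated to start at its least vertex.
  closedPath-cycle : ∀ {t ts} → Unique (t ∷ ts) → Walk D t ts t → ∃ λ c → IsCycle D c × t ∈ vertices c
  closedPath-cycle {t} {ts} t∷ts! walk with minimum t ts
  ... | m , here refl , m≤ =
    (t , ts) , (t∷ts! , All.tabulate (λ y∈ → Fin.≤∧≢⇒< (m≤ (there y∈)) (All.lookup (AllPairs.head t∷ts!) y∈)) , walk) , here refl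
  ... | m , there m∈ts , m≤ with ∈-∃++ m∈ts
  ...   | xs , ys , refl =
    (m , ys ++ t ∷ xs) , (m∷! , All.tabulate m< , walk-join ys (proj₂ split) (proj₁ split)) , there (∈-++⁺ʳ ys (here refl))
    where
    split = walk-split xs walk
    rotation : t ∷ xs ++ m ∷ ys ↭ m ∷ ys ++ t ∷ xs
    rotation = ++-comm (t ∷ xs) (m ∷ ys)
    m∷! : Unique (m ∷ ys ++ t ∷ xs)
    m∷! = unique-resp-↭ rotation t∷ts!
    m< : ∀ {y} → y ∈ ys ++ t ∷ xs → m Fin.< y
    m< y∈ = Fin.≤∧≢⇒< (m≤ (∈-resp-↭ (↭-sym rotation) (there y∈))) (All.lookup (AllPairs.head m∷!) y∈)

  -- Digraphs whose arcs form the graph of a permutation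

  module _
    (next prev : Fin n → Fin n)
    (arc-next  : ∀ {i j} → Arc D i j → next i ≡ j)
    (arc-prev  : ∀ j → Arc D (prev j) j)
    where

    walk-next : ∀ {u t x} us → Walk D u us t → x ∈ u ∷ us → next x ∈ us ⊎ next x ≡ t
    walk-next []       ut        (here refl) = inj₂ (arc-next ut)
    walk-next (v ∷ vs) (uv , _)  (here refl) = inj₁ (here (arc-next uv))
    walk-next (v ∷ vs) (_ , vt)  (there x∈) with walk-next vs vt x∈
    ... | inj₁ next∈ = inj₁ (there next∈)
    ... | inj₂ next≡ = inj₂ next≡

    -- With a single way out of each vertex, two walks can differ only in where they stop; keeping
    -- `t` out of both interiors makes them stop at the first arrival there.
    walk-determined : ∀ {u t} us vs → Walk D u us t → Walk D u vs t → t ∉ us → t ∉ vs → us ≡ vs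
    walk-determined []       []       _ _ _ _ = refl
    walk-determined []       (v ∷ vs) ut (uv , _) _ t∉ =
      contradiction (here (trans (sym (arc-next ut)) (arc-next uv))) t∉
    walk-determined (u ∷ us) []       (uv , _) ut t∉ _ =
      contradiction (here (trans (sym (arc-next ut)) (arc-next uv))) t∉
    walk-determined (u ∷ us) (v ∷ vs) (xu , ut) (xv , vt) t∉us t∉vs
      with trans (sym (arc-next xu)) (arc-next xv)
    ... | refl = cong (u ∷_) (walk-determined us vs ut vt (t∉us ∘ there) (t∉vs ∘ there))

    cycle-next : ∀ {c x} → IsCycle D c → x ∈ vertices c → next x ∈ vertices c
    cycle-next {v , vs} (_ , _ , walk) x∈ with walk-next vs walk x∈
    ... | inj₁ next∈ = there next∈
    ... | inj₂ next≡ = here next≡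

    -- A cycle is closed under `next` and a walk only follows `next`, so a walk that has met the
    -- cycle cannot leave it.
    walk-target∈ : ∀ {c u t x} us → IsCycle D c → Walk D u us t → x ∈ u ∷ us → x ∈ vertices c → t ∈ vertices c
    walk-target∈ {c} []       cyc ut        (here refl) x∈c = subst (_∈ vertices c) (arc-next ut) (cycle-next cyc x∈c)
    walk-target∈ {c} (v ∷ vs) cyc (uv , vt) (here refl) x∈c =
      walk-target∈ vs cyc vt (here refl) (subst (_∈ vertices c) (arc-next uv) (cycle-next cyc x∈c))
    walk-target∈ (v ∷ vs) cyc (_ , vt)  (there x∈)  x∈c = walk-target∈ vs cyc vt x∈ x∈c

    -- Each cycle is a walk back to its base, so after a common vertex each base lies on the other
    -- cycle. Both bases are least vertices, hence equal, and the walks from a common base are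
    -- determined.
    cycle-shared : ∀ {c d x} → IsCycle D c → IsCycle D d → x ∈ vertices c → x ∈ vertices d → c ≡ d
    cycle-shared {v , vs} {w , ws} cyc@(v∷vs! , v< , vv) cyc′@(w∷ws! , w< , ww) x∈c x∈d
      with base≡
      where
      ≤-member : ∀ {u x} {us : List (Fin n)} → All (u Fin.<_) us → x ∈ u ∷ us → u Fin.≤ x
      ≤-member u< (here refl) = Fin.≤-refl
      ≤-member u< (there x∈)  = ℕ.<⇒≤ (All.lookup u< x∈)
      base≡ : v ≡ w
      base≡ = Fin.≤-antisym
        (≤-member v< (walk-target∈ ws cyc ww x∈d x∈c))
        (≤-member w< (walk-target∈ vs cyc′ vv x∈c x∈d))
    ... | refl = cong (v ,_) (walk-determined vs ws vv ww
                   (Unique.Unique[x∷xs]⇒x∉xs v∷vs!) (Unique.Unique[x∷xs]⇒x∉xs w∷ws!))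

    -- A path ending just before t is extended backwards; prev never runs into the interior of
    -- the path, so the extension can only stop by reaching t.
    close-path : ∀ fuel {v t} vs → n ≤ length vs + fuel → Unique (v ∷ vs) → t ∉ vs → Walk D v vs t →
                 ∃ λ ts → Unique (t ∷ ts) × Walk D t ts t
    close-path zero vs n≤ v∷vs! _ _ =
      contradiction (ℕ.≤-trans (unique-length v∷vs!) (ℕ.≤-trans n≤ (ℕ.≤-reflexive (ℕ.+-identityʳ _)))) (ℕ.<-irrefl refl)
    close-path (suc fuel) {v} {t} vs n≤ v∷vs! t∉vs walk with v Fin.≟ t
    ... | yes refl = vs , v∷vs! , walk
    ... | no  v≢t  = close-path fuel (v ∷ vs) (ℕ.≤-trans n≤ (ℕ.≤-reflexive (ℕ.+-suc _ _)))
                       (All-≢ prev∉ ∷ v∷vs!)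
                       (λ { (here t≡v) → v≢t (sym t≡v) ; (there t∈vs) → t∉vs t∈vs })
                       (arc-prev v , walk)
      where
      next-prev : next (prev v) ≡ v
      next-prev = arc-next (arc-prev v)
      prev∉ : prev v ∉ v ∷ vs
      prev∉ prev∈ with walk-next vs walk prev∈
      ... | inj₁ next∈ = Unique.Unique[x∷xs]⇒x∉xs v∷vs! (subst (_∈ vs) next-prev next∈)
      ... | inj₂ next≡ = v≢t (trans (sym next-prev) next≡)

    -- The search starts from the single arc from `prev t` to `t`. Fuel `n` suffices, since each
    -- extension adds a new vertex to a path without repetitions.
    vertex-cycle : ∀ t → ∃ λ c → IsCycle D c × t ∈ vertices c
    vertex-cycle t with close-path n [] ℕ.≤-refl ([] ∷ []) (λ ()) (arc-prev t)
    ... | ts , t∷ts! , walk = closedPath-cycle t∷ts! walk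

    cycle-partition : concatMap vertices underlyingCycles ↭ allFin n
    cycle-partition = unique-↭
      (Unique.concat⁺ (All.map⁺ (All.map proj₁ underlyingCycles-isCycle))
        (AllPairs.map⁺ (disjoint underlyingCycles-isCycle underlyingCycles-unique)))
      (Unique.allFin⁺ n)
      (λ {x} _ → ∈-allFin x)
      (λ {x} _ → covered x)
      where
      disjoint : ∀ {cs} → All (IsCycle D) cs → Unique cs → AllPairs (Disjoint on vertices) cs
      disjoint []            []          = []
      disjoint (cyc ∷ cycs) (c∉ ∷ cs!) =
        All.zipWith (λ { (c≢d , cyc′) (x∈c , x∈d) → c≢d (cycle-shared cyc cyc′ x∈c x∈d) }) (c∉ , cycs) ∷ disjoint cycs cs!
      covered : ∀ x → x ∈ concatMap vertices underlyingCycles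
      covered x with vertex-cycle x
      ... | c , cyc , x∈c = ∈-concat⁺′ x∈c (∈-map⁺ vertices (∈-underlyingCycles⁺ cyc))

    private
      -- The induction passes to suffixes of the cycle, whose end `t` need not be their start `v`.
      -- At the last vertex the partial product returns to `v` while `next` leads to `t`; the two
      -- agree once the whole cycle is taken and `t` is `v`.
      walk-permutation : ∀ {v t x} vs → Unique (v ∷ vs) → Walk D v vs t → x ∈ v ∷ vs →
        (next x ≡ t × cyclePermutation v vs x ≡ v) ⊎ (next x ∈ vs × cyclePermutation v vs x ≡ next x)
      walk-permutation []           _ vt (here refl) = inj₁ (arc-next vt , refl)
      walk-permutation {v} (w ∷ ws) (v≢ ∷ _) (vw , wt) (here refl) =
        inj₂ (here (arc-next vw) ,
          trans (cong (transpose v w) (cyclePermutation-outside w ws (All.All¬⇒¬Any v≢)))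
            (trans (transpose-left v w) (sym (arc-next vw))))
      walk-permutation {v} (w ∷ ws) (v≢ ∷ w∷ws!@(w≢ ∷ _)) (vw , wt) (there x∈) with walk-permutation ws w∷ws! wt x∈
      ... | inj₁ (next≡t , eq) = inj₁ (next≡t , trans (cong (transpose v w) eq) (transpose-right v w))
      ... | inj₂ (next∈ws , eq) = inj₂ (there next∈ws ,
              trans (cong (transpose v w) eq)
                (transpose-other (All.lookup v≢ (there next∈ws) ∘ sym) (All.lookup w≢ next∈ws ∘ sym)))

    cyclePermutation-next : ∀ {v vs x} → IsCycle D (v , vs) → x ∈ v ∷ vs → cyclePermutation v vs x ≡ next x
    cyclePermutation-next {v} {vs} (v∷vs! , _ , walk) x∈ with walk-permutation vs v∷vs! walk x∈
    ... | inj₁ (next≡v , eq) = trans eq (sym next≡v)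
    ... | inj₂ (_      , eq) = eq

    -- `next x` stays on the cycle of `x`, so by disjointness the factors applied before this cycle
    -- fix `x` and those applied after it fix `next x`.
    cyclesPermutation-next : ∀ {cs x} → All (IsCycle D) cs → Unique (concatMap vertices cs) →
                             x ∈ concatMap vertices cs → cyclesPermutation cs x ≡ next x
    cyclesPermutation-next {(v , vs) ∷ cs} {x} (cyc ∷ cycs) unique x∈ with unique-++⁻ (v ∷ vs) unique | ∈-++⁻ (v ∷ vs) x∈
    ... | disjoint , _ | inj₁ x∈c =
      trans (cong (cyclePermutation v vs) (cyclesPermutation-outside cs (λ x∈cs → disjoint (x∈c , x∈cs))))
        (cyclePermutation-next cyc x∈c)
    ... | disjoint , cs! | inj₂ x∈cs =
      trans (cong (cyclePermutation v vs) (cyclesPermutation-next cycs cs! x∈cs))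
        (cyclePermutation-outside _ _ (λ next∈c → disjoint (next∈c , next∈cs)))
      where
      next∈concat : ∀ {cs x} → All (IsCycle D) cs → x ∈ concatMap vertices cs → next x ∈ concatMap vertices cs
      next∈concat {c ∷ _} (cyc ∷ cycs) x∈ with ∈-++⁻ (vertices c) x∈
      ... | inj₁ x∈c  = ∈-++⁺ˡ (cycle-next cyc x∈c)
      ... | inj₂ x∈cs = ∈-++⁺ʳ (vertices c) (next∈concat cycs x∈cs)
      next∈cs = next∈concat cycs x∈cs

    next-parity : parity (listInversions (map next (allFin n))) ≡ parity (n ∸ length (cycles D))
    next-parity = begin
      parity (listInversions (map next (allFin n)))
        ≡⟨ cong (parity ∘ listInversions) (List.map-cong permutation≡ (allFin n)) ⟨
      parity (listInversions (map (cyclesPermutation cs) (allFin n)))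
        ≡⟨ proj₂ (cyclesPermutation-parity cs (All.map proj₁ underlyingCycles-isCycle)) ⟩
      parity (transpositions cs)
        -- Adding one per cycle turns the number of transpositions into the number of vertices, so
        -- the truncated subtraction loses nothing.
        ≡⟨ cong parity (ℕ.m+n∸n≡m (transpositions cs) (length cs)) ⟨
      parity (transpositions cs + length cs ∸ length cs)
        ≡⟨ cong₂ (λ k l → parity (k ∸ l)) count (List.length-map proj₁ (cycles D)) ⟩
      parity (n ∸ length (cycles D)) ∎
      where
      open ≡-Reasoning
      cs = underlyingCycles
      permutation≡ : ∀ x → cyclesPermutation cs x ≡ next x
      permutation≡ x = cyclesPermutation-next underlyingCycles-isCycle
        (unique-resp-↭ (↭-sym cycle-partition) (Unique.allFin⁺ n))
        (∈-resp-↭ (↭-sym cycle-partition) (∈-allFin x))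
      count : transpositions cs + length cs ≡ n
      count = trans (sym (length-vertices cs)) (trans (↭-length cycle-partition) (List.length-tabulate {n = n} id))

-- Sums and products over lists

module _ {c ℓ} (M : CommutativeMonoid c ℓ) where
  open CommutativeMonoid M renaming (refl to ≈-refl; sym to ≈-sym; trans to ≈-trans)

  -- `sumOver` and `productOver` unfold to this for the additive and the multiplicative monoid, so
  -- that each lemma below serves both.
  fold : List A → (A → Carrier) → Carrier
  fold xs f = foldr _∙_ ε (map f xs)

  fold-cong : ∀ {f g : A → Carrier} xs → (∀ x → f x ≈ g x) → fold xs f ≈ fold xs g
  fold-cong []       f≈g = ≈-refl
  fold-cong (x ∷ xs) f≈g = ∙-cong (f≈g x) (fold-cong xs f≈g)

  fold-map : ∀ (f : B → Carrier) (g : A → B) xs → fold (map g xs) f ≈ fold xs (f ∘ g)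
  fold-map f g xs = reflexive (cong (foldr _∙_ ε) (sym (List.map-∘ xs)))

  fold-++ : ∀ (f : A → Carrier) xs ys → fold (xs ++ ys) f ≈ fold xs f ∙ fold ys f
  fold-++ f []       ys = ≈-sym (identityˡ _)
  fold-++ f (x ∷ xs) ys = ≈-trans (∙-congˡ (fold-++ f xs ys)) (≈-sym (assoc _ _ _))

  fold-concatMap : ∀ (f : B → Carrier) (g : A → List B) xs →
                   fold (concatMap g xs) f ≈ fold xs (λ x → fold (g x) f)
  fold-concatMap f g []       = ≈-refl
  fold-concatMap f g (x ∷ xs) = ≈-trans (fold-++ f (g x) _) (∙-congˡ (fold-concatMap f g xs))

  fold-↭ : ∀ (f : A → Carrier) {xs ys} → xs ↭ ys → fold xs f ≈ fold ys f
  fold-↭ f Perm.refl                  = ≈-refl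
  fold-↭ f (Perm.prep x xs↭ys)        = ∙-congˡ (fold-↭ f xs↭ys)
  fold-↭ f (Perm.swap x y xs↭ys)      =
    ≈-trans (≈-sym (assoc _ _ _)) (≈-trans (∙-cong (comm _ _) (fold-↭ f xs↭ys)) (assoc _ _ _))
  fold-↭ f (Perm.trans xs↭ys ys↭zs)   = ≈-trans (fold-↭ f xs↭ys) (fold-↭ f ys↭zs)

module _ {c ℓ} (R : CommutativeRing c ℓ) where
  open CommutativeRing R renaming (refl to ≈-refl; sym to ≈-sym; trans to ≈-trans)
  open RingProperties ring using (-1*x≈-x; -‿involutive)

  productOver-zero : ∀ {f : A → Carrier} {x xs} → x ∈ xs → f x ≈ 0# → productOver R xs f ≈ 0#
  productOver-zero (here refl) fx≈0 = ≈-trans (*-congʳ fx≈0) (zeroˡ _)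
  productOver-zero (there x∈)  fx≈0 = ≈-trans (*-congˡ (productOver-zero x∈ fx≈0)) (zeroʳ _)

  sumOver-filter : ∀ {P : Pred A p} (P? : Decidable P) {f : A → Carrier} xs →
                   (∀ x → ¬ P x → f x ≈ 0#) → sumOver R xs f ≈ sumOver R (filter P? xs) f
  sumOver-filter P? []       f≈0 = ≈-refl
  sumOver-filter P? (x ∷ xs) f≈0 with P? x
  ... | yes _  = +-congˡ (sumOver-filter P? xs f≈0)
  ... | no ¬px = ≈-trans (+-cong (f≈0 x ¬px) (sumOver-filter P? xs f≈0)) (+-identityˡ _)

  sign-suc-suc : ∀ k → sign R (suc (suc k)) ≈ sign R k
  sign-suc-suc k = ≈-trans (-1*x≈-x _) (≈-trans (-‿cong (-1*x≈-x _)) (-‿involutive _))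

  sign-parity : ∀ j k → parity j ≡ parity k → sign R j ≈ sign R k
  sign-parity 0 0 _ = ≈-refl
  sign-parity 1 1 _ = ≈-refl
  sign-parity (suc (suc j)) k eq = ≈-trans (sign-suc-suc j) (sign-parity j k eq)
  sign-parity 0 (suc (suc k)) eq = ≈-trans (sign-parity 0 k eq) (≈-sym (sign-suc-suc k))
  sign-parity 1 (suc (suc k)) eq = ≈-trans (sign-parity 1 k eq) (≈-sym (sign-suc-suc k))

-- Spanning elementary subdigraphs and permutations

∣S∣≡0⇒⊥ : ∀ (S : Subset n) → ∣ S ∣ ≡ 0 → S ≡ Subset.⊥
∣S∣≡0⇒⊥ []            _  = refl
∣S∣≡0⇒⊥ (outside ∷ S) eq = cong (outside ∷_) (∣S∣≡0⇒⊥ S eq)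

∣S∣≡1⇒⁅⁆ : ∀ (S : Subset n) → ∣ S ∣ ≡ 1 → ∃ λ x → S ≡ ⁅ x ⁆
∣S∣≡1⇒⁅⁆ (inside ∷ S)  eq = zero , cong (inside ∷_) (∣S∣≡0⇒⊥ S (ℕ.suc-injective eq))
∣S∣≡1⇒⁅⁆ (outside ∷ S) eq with ∣S∣≡1⇒⁅⁆ S eq
... | x , refl = suc x , refl

unique-member⇒∣S∣≡1 : ∀ {S : Subset n} {x} → x Subset.∈ S → (∀ {y} → y Subset.∈ S → y ≡ x) → ∣ S ∣ ≡ 1
unique-member⇒∣S∣≡1 {S = S} {x} x∈S unique = trans (cong ∣_∣ S≡⁅x⁆) (Subset.∣⁅x⁆∣≡1 x)
  where
  S≡⁅x⁆ : S ≡ ⁅ x ⁆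
  S≡⁅x⁆ = Subset.⊆-antisym
    (λ y∈S → subst (Subset._∈ ⁅ x ⁆) (sym (unique y∈S)) (Subset.x∈⁅x⁆ x))
    (λ y∈⁅x⁆ → subst (Subset._∈ S) (sym (Subset.x∈⁅y⁆⇒x≡y x y∈⁅x⁆)) x∈S)

⁅⁆-injective : ∀ {x y : Fin n} → ⁅ x ⁆ ≡ ⁅ y ⁆ → x ≡ y
⁅⁆-injective {x = x} {y} eq = Subset.x∈⁅y⁆⇒x≡y y (subst (x Subset.∈_) eq (Subset.x∈⁅x⁆ x))

column : ArcSet n → Fin n → Subset n
column B j = Vec.map (λ N → lookup N j) B

∈-column⁺ : ∀ (B : ArcSet n) {i j} → j Subset.∈ lookup B i → i Subset.∈ column B j
∈-column⁺ B {i} {j} j∈ = Vec.lookup⇒[]= i _ (trans (Vec.lookup-map i _ B) (Vec.[]=⇒lookup j∈))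

∈-column⁻ : ∀ (B : ArcSet n) {i j} → i Subset.∈ column B j → j Subset.∈ lookup B i
∈-column⁻ B {i} {j} i∈ = Vec.lookup⇒[]= j _ (trans (sym (Vec.lookup-map i _ B)) (Vec.[]=⇒lookup i∈))

toList-tabulate : ∀ (f : Fin n → A) → toList (Vec.tabulate f) ≡ tabulate f
toList-tabulate {n = zero}  f = refl
toList-tabulate {n = suc n} f = cong (f zero ∷_) (toList-tabulate (f ∘ suc))

-- A missed value could be put in front of `σ`, giving `n + 1` distinct elements of `Fin n`.
toList-unique⇒surjective : ∀ (σ : Vec (Fin n) n) → Unique (toList σ) → ∀ j → ∃ λ i → lookup σ i ≡ j
toList-unique⇒surjective {n} σ σ! j with Fin.any? (λ i → lookup σ i Fin.≟ j)
... | yes found = found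
... | no  none  = contradiction (unique-length (All-≢ j∉σ ∷ σ!))
                    (ℕ.<-irrefl (Vec.length-toList σ))
  where
  j∉σ : j ∉ toList σ
  j∉σ j∈σ with ∈-tabulate⁻ (subst (j ∈_) (trans (cong toList (sym (Vec.tabulate∘lookup σ))) (toList-tabulate (lookup σ))) j∈σ)
  ... | i , j≡σi = none (i , sym j≡σi)

toList-unique⇒injective : ∀ {σ : Vec A n} → Unique (toList σ) → ∀ i j → lookup σ i ≡ lookup σ j → i ≡ j
toList-unique⇒injective {σ = x ∷ σ} (x∉ ∷ σ!) zero    zero    eq = refl
toList-unique⇒injective {σ = x ∷ σ} (x∉ ∷ σ!) zero    (suc j) eq =
  contradiction eq (All.lookup x∉ (∈-toList⁺ (∈-lookupᵛ j σ)))
toList-unique⇒injective {σ = x ∷ σ} (x∉ ∷ σ!) (suc i) zero    eq =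
  contradiction (sym eq) (All.lookup x∉ (∈-toList⁺ (∈-lookupᵛ i σ)))
toList-unique⇒injective {σ = x ∷ σ} (x∉ ∷ σ!) (suc i) (suc j) eq = cong suc (toList-unique⇒injective σ! i j eq)

Compatible : Digraph n → Vec (Fin n) n → Set
Compatible D σ = ∀ i → Arc D i (lookup σ i)

compatible? : (D : Digraph n) → Decidable (Compatible D)
compatible? D σ = Fin.all? λ i → lookup σ i Subset.∈? lookup (arcs D) i

compatiblePermutations : Digraph n → List (Vec (Fin n) n)
compatiblePermutations {n} D = filter (compatible? D) (permutations n)

singletons : Vec (Fin n) n → ArcSet n
singletons = Vec.map ⁅_⁆

singletons-injective : {σ τ : Vec (Fin m) n} → Vec.map ⁅_⁆ σ ≡ Vec.map ⁅_⁆ τ → σ ≡ τ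
singletons-injective {σ = []}    {[]}    _  = refl
singletons-injective {σ = x ∷ σ} {y ∷ τ} eq with Vec.∷-injective eq
... | ⁅x⁆≡⁅y⁆ , eq′ = cong₂ _∷_ (⁅⁆-injective ⁅x⁆≡⁅y⁆) (singletons-injective eq′)

-- The in-degrees are where `σ` has to be a permutation: surjectivity puts some `i` into each column
-- and injectivity excludes a second.
singletons-elementary : (D : Digraph n) → ∀ {σ} → Unique (toList σ) → Compatible D σ →
                        IsSpanningElementary D (singletons σ)
singletons-elementary D {σ} σ! compatible = rows⊆ , out≡1 , in≡1
  where
  row : ∀ i → lookup (singletons σ) i ≡ ⁅ lookup σ i ⁆
  row i = Vec.lookup-map i ⁅_⁆ σ
  rows⊆ : ∀ i → lookup (singletons σ) i Subset.⊆ lookup (arcs D) i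
  rows⊆ i {j} j∈ = subst (Subset._∈ lookup (arcs D) i)
    (sym (Subset.x∈⁅y⁆⇒x≡y _ (subst (j Subset.∈_) (row i) j∈))) (compatible i)
  out≡1 : ∀ i → outDegree (singletons σ) i ≡ 1
  out≡1 i = trans (cong ∣_∣ (row i)) (Subset.∣⁅x⁆∣≡1 (lookup σ i))
  in≡1 : ∀ j → inDegree (singletons σ) j ≡ 1
  in≡1 j with toList-unique⇒surjective σ σ! j
  ... | i , refl = unique-member⇒∣S∣≡1
    (∈-column⁺ (singletons σ) (subst (lookup σ i Subset.∈_) (sym (row i)) (Subset.x∈⁅x⁆ _)))
    (λ {k} k∈ → toList-unique⇒injective σ! k i
      (sym (Subset.x∈⁅y⁆⇒x≡y _ (subst (lookup σ i Subset.∈_) (row k) (∈-column⁻ (singletons σ) k∈)))))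

module _ (D : Digraph n) where

  successor : SpanningElementary D → Fin n → Fin n
  successor (B , _ , out≡1 , _) i = proj₁ (∣S∣≡1⇒⁅⁆ (lookup B i) (out≡1 i))

  predecessor : SpanningElementary D → Fin n → Fin n
  predecessor (B , _ , _ , in≡1) j = proj₁ (∣S∣≡1⇒⁅⁆ (column B j) (in≡1 j))

  successors : SpanningElementary D → Vec (Fin n) n
  successors E = Vec.tabulate (successor E)

  row≡⁅successor⁆ : ∀ E i → lookup (proj₁ E) i ≡ ⁅ successor E i ⁆
  row≡⁅successor⁆ (B , _ , out≡1 , _) i = proj₂ (∣S∣≡1⇒⁅⁆ (lookup B i) (out≡1 i))

  column≡⁅predecessor⁆ : ∀ E j → column (proj₁ E) j ≡ ⁅ predecessor E j ⁆
  column≡⁅predecessor⁆ (B , _ , _ , in≡1) j = proj₂ (∣S∣≡1⇒⁅⁆ (column B j) (in≡1 j))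

  arc-successor : ∀ E i → Arc (subdigraph D E) i (successor E i)
  arc-successor E i = subst (successor E i Subset.∈_) (sym (row≡⁅successor⁆ E i)) (Subset.x∈⁅x⁆ _)

  arc⇒successor : ∀ E {i j} → Arc (subdigraph D E) i j → successor E i ≡ j
  arc⇒successor E {i} {j} ij = sym (Subset.x∈⁅y⁆⇒x≡y _ (subst (j Subset.∈_) (row≡⁅successor⁆ E i) ij))

  arc-predecessor : ∀ E j → Arc (subdigraph D E) (predecessor E j) j
  arc-predecessor E j = ∈-column⁻ (proj₁ E)
    (subst (predecessor E j Subset.∈_) (sym (column≡⁅predecessor⁆ E j)) (Subset.x∈⁅x⁆ _))

  arc⇒predecessor : ∀ E {i j} → Arc (subdigraph D E) i j → i ≡ predecessor E j
  arc⇒predecessor E {i} {j} ij =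
    Subset.x∈⁅y⁆⇒x≡y _ (subst (i Subset.∈_) (column≡⁅predecessor⁆ E j) (∈-column⁺ (proj₁ E) ij))

  successor-injective : ∀ E {i j} → successor E i ≡ successor E j → i ≡ j
  successor-injective E {i} {j} eq = trans (arc⇒predecessor E (arc-successor E i))
    (trans (cong (predecessor E) eq) (sym (arc⇒predecessor E (arc-successor E j))))

  singletons-successors : ∀ E → singletons (successors E) ≡ proj₁ E
  singletons-successors E = begin
    singletons (successors E)            ≡⟨ Vec.tabulate-∘ ⁅_⁆ (successor E) ⟨
    Vec.tabulate (⁅_⁆ ∘ successor E)     ≡⟨ Vec.tabulate-cong (λ i → sym (row≡⁅successor⁆ E i)) ⟩
    Vec.tabulate (lookup (proj₁ E))      ≡⟨ Vec.tabulate∘lookup (proj₁ E) ⟩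
    proj₁ E                              ∎
    where open ≡-Reasoning

  private
    arcSets : List (ArcSet n)
    arcSets = allVecs (allVecs (inside ∷ outside ∷ []) n) n

    ∈-arcSets : ∀ B → B ∈ arcSets
    ∈-arcSets = ∈-allVecs (∈-allVecs λ { inside → here refl ; outside → there (here refl) })

    arcSets-unique : Unique arcSets
    arcSets-unique = allVecs-unique (allVecs-unique (((λ ()) ∷ []) ∷ [] ∷ []) n) n

    spanningElementaries-filter : map proj₁ (spanningElementaries D) ≡ filter (isSpanningElementary? D) arcSets
    spanningElementaries-filter = map-proj₁-witnesses (isSpanningElementary? D) arcSets

  successors-↭ : map successors (spanningElementaries D) ↭ compatiblePermutations D
  successors-↭ = unique-↭ successors-unique
    (Unique.filter⁺ (compatible? D) (Unique.filter⁺ unique? (allVecs-unique (Unique.allFin⁺ n) n)))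
    sound complete
    where
    open DecUnique Fin._≟_ using () renaming (unique? to unique-list?)
    unique? : Decidable (λ (σ : Vec (Fin n) n) → Unique (toList σ))
    unique? σ = unique-list? (toList σ)
    successors-unique : Unique (map successors (spanningElementaries D))
    -- `singletons` recovers the arc set from the successors, so a repetition here would be one in
    -- the filtered enumeration of arc sets.
    successors-unique = Unique.map⁻ {f = singletons} (subst Unique (sym eq)
      (Unique.filter⁺ (isSpanningElementary? D) arcSets-unique))
      where
      eq : map singletons (map successors (spanningElementaries D)) ≡ filter (isSpanningElementary? D) arcSets
      eq = trans (sym (List.map-∘ (spanningElementaries D)))
        (trans (List.map-cong singletons-successors (spanningElementaries D)) spanningElementaries-filter)
    sound : ∀ {σ} → σ ∈ map successors (spanningElementaries D) → σ ∈ compatiblePermutations D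
    sound σ∈ with ∈-map⁻ successors σ∈
    ... | E@(_ , B⊆D , _) , _ , refl = ∈-filter⁺ (compatible? D)
      (∈-filter⁺ unique? (∈-allVecs ∈-allFin (successors E))
        (subst Unique (sym (toList-tabulate (successor E))) (Unique.tabulate⁺ (successor-injective E))))
      (λ i → subst (Arc D i) (sym (Vec.lookup∘tabulate (successor E) i)) (B⊆D i (arc-successor E i)))
    complete : ∀ {σ} → σ ∈ compatiblePermutations D → σ ∈ map successors (spanningElementaries D)
    complete {σ} σ∈ with ∈-filter⁻ (compatible? D) {xs = permutations n} σ∈
    ... | σ∈perms , compatible
      with ∈-map⁻ proj₁ (subst (singletons σ ∈_) (sym spanningElementaries-filter)
             (∈-filter⁺ (isSpanningElementary? D) (∈-arcSets (singletons σ))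
               (singletons-elementary D (proj₂ (∈-filter⁻ unique? {xs = allVecs (allFin n) n} σ∈perms)) compatible)))
    -- `E` is found through its arc set `singletons σ`; injectivity of `singletons` then identifies
    -- its successors with `σ`.
    ... | E , E∈ , eq = subst (_∈ map successors (spanningElementaries D))
      (singletons-injective (trans (singletons-successors E) (sym eq)))
      (∈-map⁺ successors E∈)

  successors-parity : ∀ E → parity (inversions (successors E)) ≡ parity (n ∸ cycleCount D E)
  successors-parity E = begin
    parity (inversions (successors E))
      ≡⟨ cong parity (inversions-list (successors E)) ⟩
    parity (listInversions (map (lookup (successors E)) (allFin n)))
      ≡⟨ cong (parity ∘ listInversions) (List.map-cong (Vec.lookup∘tabulate (successor E)) (allFin n)) ⟩
    parity (listInversions (map (successor E) (allFin n)))
      ≡⟨ next-parity (subdigraph D E) (successor E) (predecessor E) (arc⇒successor E) (arc-predecessor E) ⟩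
    parity (n ∸ cycleCount D E) ∎
    where open ≡-Reasoning

  -- Gains and the terms of the Leibniz expansion

  module _ (φ : Gain D) where
    open CommutativeRing ℂ-commutativeRing 
      using (setoid; reflexive; *-commutativeMonoid; *-cong; *-congˡ; *-identityʳ; zeroʳ)
      renaming (refl to ≈-refl; sym to ≈-sym; trans to ≈-trans)

    private
      M : Fin n → Fin n → ℂ
      M = adjacencyMatrix D φ

    -- A gain takes the proof of the arc as an argument. Membership proofs are irrelevant, so the
    -- one found by the decision procedure can be exchanged for any other, such as one inherited
    -- from a subdigraph.
    adjacencyMatrix-arc : ∀ {i j} (ij : Arc D i j) → adjacencyMatrix D φ i j ≡ proj₁ (φ i j ij)
    adjacencyMatrix-arc {i} {j} ij with j Subset.∈? lookup (arcs D) i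
    ... | yes ij′ = cong (proj₁ ∘ φ i j) ([]=-irrelevant ij′ ij)
    ... | no ¬ij  = contradiction ij ¬ij

    adjacencyMatrix-nonarc : ∀ {i j} → ¬ Arc D i j → adjacencyMatrix D φ i j ≡ 0ℂ
    adjacencyMatrix-nonarc {i} {j} ¬ij with j Subset.∈? lookup (arcs D) i
    ... | yes ij = contradiction ij ¬ij
    ... | no _   = refl

    leibnizTerm : Vec (Fin n) n → ℂ
    leibnizTerm σ = sign ℂ-commutativeRing (inversions σ) *ℂ
                    productOver ℂ-commutativeRing (allFin n) (λ i → M i (lookup σ i))

    leibnizTerm-incompatible : ∀ σ → ¬ Compatible D σ → leibnizTerm σ ≈ℂ 0ℂ
    leibnizTerm-incompatible σ ¬compatible
      with Fin.¬∀⟶∃¬ n (λ i → Arc D i (lookup σ i)) (λ i → lookup σ i Subset.∈? lookup (arcs D) i) ¬compatible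
    ... | i , ¬arc = ≈-trans
      (*-congˡ (productOver-zero ℂ-commutativeRing (∈-allFin i) (reflexive (adjacencyMatrix-nonarc ¬arc))))
      (zeroʳ _)

    module _ (E : SpanningElementary D) where

      -- Charging each arc to its tail makes the gain of a cycle a product over its vertices, to
      -- which the partition of the vertices applies.
      successorGain : Fin n → ℂ
      successorGain i = M i (successor E i)

      restrictGain-successor : ∀ {i j} (ij : Arc (subdigraph D E) i j) →
                               proj₁ (restrictGain D E φ i j ij) ≡ successorGain i
      restrictGain-successor {i} ij =
        trans (sym (adjacencyMatrix-arc (proj₁ (proj₂ E) i ij))) (cong (M i) (sym (arc⇒successor E ij)))

      walkGain-product : ∀ u us t (w : Walk (subdigraph D E) u us t) →
        walkGain (subdigraph D E) (restrictGain D E φ) u us t w ≈ℂ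
        productOver ℂ-commutativeRing (u ∷ us) successorGain
      walkGain-product u []       t ut       =
        ≈-trans (reflexive (restrictGain-successor ut)) (≈-sym (*-identityʳ _))
      walkGain-product u (v ∷ vs) t (uv , w) =
        *-cong (reflexive (restrictGain-successor uv)) (walkGain-product v vs t w)

      elementaryGain-product : elementaryGain D φ E ≈ℂ productOver ℂ-commutativeRing (allFin n) successorGain
      elementaryGain-product = begin
        fold ∏ (cycles E′) (cycleGain E′ (restrictGain D E φ))
          ≈⟨ fold-cong ∏ (cycles E′) (λ { ((v , vs) , _ , _ , w) → walkGain-product v vs v w }) ⟩
        fold ∏ (cycles E′) (λ c → fold ∏ (vertices (proj₁ c)) successorGain)
          ≈⟨ fold-map ∏ _ proj₁ (cycles E′) ⟨
        fold ∏ (underlyingCycles E′) (λ c → fold ∏ (vertices c) successorGain)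
          ≈⟨ fold-concatMap ∏ successorGain vertices (underlyingCycles E′) ⟨
        fold ∏ (concatMap vertices (underlyingCycles E′)) successorGain
          ≈⟨ fold-↭ ∏ successorGain
               (cycle-partition E′ (successor E) (predecessor E) (arc⇒successor E) (arc-predecessor E)) ⟩
        fold ∏ (allFin n) successorGain ∎
        where
        open SetoidReasoning setoid
        ∏ = *-commutativeMonoid
        E′ = subdigraph D E

      leibnizTerm-elementary : leibnizTerm (successors E) ≈ℂ
        sign ℂ-commutativeRing (n ∸ cycleCount D E) *ℂ elementaryGain D φ E
      leibnizTerm-elementary = *-cong
        (sign-parity ℂ-commutativeRing (inversions (successors E)) (n ∸ cycleCount D E) (successors-parity E))
        (≈-trans
          (fold-cong *-commutativeMonoid (allFin n) (λ i → reflexive (cong (M i) (Vec.lookup∘tabulate (successor E) i))))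
          (≈-sym elementaryGain-product))

theorem2p4 : ∀ (n : ℕ) (D : Digraph n) (φ : Gain D) →
    det ℂ-commutativeRing (adjacencyMatrix D φ)
      ≈ℂ sumOver ℂ-commutativeRing (spanningElementaries D)
           (λ E → sign ℂ-commutativeRing (n ∸ cycleCount D E) *ℂ elementaryGain D φ E)
theorem2p4 n D φ = begin
  fold ∑ (permutations n) (leibnizTerm D φ)
    ≈⟨ sumOver-filter ℂ-commutativeRing (compatible? D) (permutations n) (leibnizTerm-incompatible D φ) ⟩
  fold ∑ (compatiblePermutations D) (leibnizTerm D φ)
    ≈⟨ fold-↭ ∑ (leibnizTerm D φ) (successors-↭ D) ⟨
  fold ∑ (map (successors D) (spanningElementaries D)) (leibnizTerm D φ)
    ≈⟨ fold-map ∑ (leibnizTerm D φ) (successors D) (spanningElementaries D) ⟩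
  fold ∑ (spanningElementaries D) (leibnizTerm D φ ∘ successors D)
    ≈⟨ fold-cong ∑ (spanningElementaries D) (leibnizTerm-elementary D φ) ⟩
  fold ∑ (spanningElementaries D) (λ E → sign ℂ-commutativeRing (n ∸ cycleCount D E) *ℂ elementaryGain D φ E) ∎
  where
  open CommutativeRing ℂ-commutativeRing using (setoid; +-commutativeMonoid)
  open SetoidReasoning setoid
  ∑ = +-commutativeMonoid
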